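{- Let $b,s,k>0$ be integers such that $$D=D(b,s,k)=(4bs+1)^k+\bigl(b(4bs+1)^k+s\bigr)^2$$ is squarefree. If $4bs+1$ is not a prime, then $h(D)>1$.
   Context: For a squarefree integer $D>1$, $h(D)$ denotes the class number of the real quadratic field $\mathbb{Q}(\sqrt D)$. -}

module Defs where

open import Data.Nat.Base as ℕ using (ℕ)
open import Data.Nat.Divisibility using (_∣_)
open import Data.Integer.Base as ℤ using (ℤ)
open import Data.Rational.Base as ℚ using (ℚ; 0ℚ; 1ℚ)
open import Data.Rational.Solver using (module +-*-Solver)
open import Data.Fin.Base using (Fin)
open import Data.List.Base using (List; []; _∷_)
open import Data.List.Relation.Unary.Any using (Any)
open import Data.Product.Base using (∃; ∃₂; _×_; _,_)
open import Function.Bundles using (Bijection)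
open import Level using (0ℓ)
open import Relation.Binary.Bundles using (Setoid)
open import Relation.Binary.Structures using (IsEquivalence)
open import Relation.Binary.PropositionalEquality
  using (_≡_; _≢_; refl; sym; trans; cong; cong₂; subst; setoid)
open import Relation.Unary using (Pred; _≐_)

Squarefree : ℕ → Set
Squarefree n = ∀ d → d ℕ.* d ∣ n → d ≡ 1

D : ℕ → ℕ → ℕ → ℕ
D b s k = n^k ℕ.+ (b ℕ.* n^k ℕ.+ s) ℕ.^ 2
  where n^k = (4 ℕ.* b ℕ.* s ℕ.+ 1) ℕ.^ k

fromℤ : ℤ → ℚ
fromℤ i = i ℚ./ 1

-- x +√ y stands for x + y√d.  This is the field ℚ(√d) only when d is not a
-- perfect square, e.g. when d > 1 is squarefree.

infix 5 _+√_

record ℚ[√_] (d : ℕ) : Set where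
  constructor _+√_
  field
    rat  : ℚ
    surd : ℚ

module QuadraticField (d : ℕ) where

  K : Set
  K = ℚ[√ d ]

  infixl 6 _+_
  infixl 7 _*_

  0K 1K : K
  0K = 0ℚ +√ 0ℚ
  1K = 1ℚ +√ 0ℚ

  _+_ : K → K → K
  (x +√ y) + (x′ +√ y′) = x ℚ.+ x′ +√ y ℚ.+ y′

  _*_ : K → K → K
  (x +√ y) * (x′ +√ y′) =
    x ℚ.* x′ ℚ.+ fromℤ (ℤ.+ d) ℚ.* (y ℚ.* y′) +√ x ℚ.* y′ ℚ.+ y ℚ.* x′

  -- Horner evaluation at α of the monic polynomial
  -- c₀ + c₁ X + … + cₘ₋₁ Xᵐ⁻¹ + Xᵐ given by the list c₀ ∷ c₁ ∷ … ∷ cₘ₋₁ ∷ [].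
  evalMonic : List ℤ → K → K
  evalMonic []       α = 1K
  evalMonic (c ∷ cs) α = (fromℤ c +√ 0ℚ) + α * evalMonic cs α

  -- Membership in the ring of integers.
  Integral : Pred K 0ℓ
  Integral α = ∃ λ (cs : List ℤ) → evalMonic cs α ≡ 0K

  Span : List K → Pred K 0ℓ
  Span []       x = x ≡ 0K
  Span (g ∷ gs) x = ∃₂ λ c y → Integral c × Span gs y × x ≡ c * g + y

  -- Since the ring of integers is Noetherian, its fractional ideals are exactly
  -- the finitely generated submodules of K other than 0.
  record FractionalIdeal : Set where
    field
      generators : List K
      nonzero    : Any (_≢ 0K) generators

    Member : Pred K 0ℓ
    Member = Span generators

  open FractionalIdeal public

  _·_ : K → Pred K 0ℓ → Pred K 0ℓ
  (u · I) x = ∃ λ y → I y × x ≡ u * y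

  -- Equality of ideal classes: J = uI for some u ∈ K^×, with inverse v.
  _∼_ : FractionalIdeal → FractionalIdeal → Set
  I ∼ J = ∃₂ λ u v → u * v ≡ 1K × Member J ≐ (u · Member I)

  *-comm : ∀ x y → x * y ≡ y * x
  *-comm (a +√ b) (a′ +√ b′) = cong₂ _+√_
    (solve 5 (λ a b a′ b′ e → a :* a′ :+ e :* (b :* b′)
                           := a′ :* a :+ e :* (b′ :* b)) refl a b a′ b′ e)
    (solve 4 (λ a b a′ b′ → a :* b′ :+ b :* a′ := a′ :* b :+ b′ :* a)
      refl a b a′ b′)
    where
    open +-*-Solver
    e = fromℤ (ℤ.+ d)

  *-assoc : ∀ x y z → (x * y) * z ≡ x * (y * z)
  *-assoc (a +√ b) (a′ +√ b′) (a″ +√ b″) = cong₂ _+√_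
    (solve 7 (λ a b a′ b′ a″ b″ e →
         (a :* a′ :+ e :* (b :* b′)) :* a″ :+ e :* ((a :* b′ :+ b :* a′) :* b″)
      := a :* (a′ :* a″ :+ e :* (b′ :* b″)) :+ e :* (b :* (a′ :* b″ :+ b′ :* a″)))
      refl a b a′ b′ a″ b″ e)
    (solve 7 (λ a b a′ b′ a″ b″ e →
         (a :* a′ :+ e :* (b :* b′)) :* b″ :+ (a :* b′ :+ b :* a′) :* a″
      := a :* (a′ :* b″ :+ b′ :* a″) :+ b :* (a′ :* a″ :+ e :* (b′ :* b″)))
      refl a b a′ b′ a″ b″ e)
    where
    open +-*-Solver
    e = fromℤ (ℤ.+ d)

  *-identityˡ : ∀ x → 1K * x ≡ x
  *-identityˡ (a +√ b) = cong₂ _+√_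
    (solve 3 (λ a b e → con 1ℚ :* a :+ e :* (con 0ℚ :* b) := a) refl a b e)
    (solve 2 (λ a b → con 1ℚ :* b :+ con 0ℚ :* a := b) refl a b)
    where
    open +-*-Solver
    e = fromℤ (ℤ.+ d)

  cancel : ∀ u v → u * v ≡ 1K → ∀ x → u * (v * x) ≡ x
  cancel u v uv≡1 x =
    trans (sym (*-assoc u v x)) (trans (cong (_* x) uv≡1) (*-identityˡ x))

  ∼-refl : ∀ {I} → I ∼ I
  ∼-refl {I} =
    1K , 1K , *-identityˡ 1K
    , (λ {x} p → x , p , sym (*-identityˡ x))
    , λ { (y , p , refl) → subst (Member I) (sym (*-identityˡ y)) p }

  ∼-sym : ∀ {I J} → I ∼ J → J ∼ I
  ∼-sym {I} {J} (u , v , uv≡1 , J⊆uI , uI⊆J) =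
    v , u , vu≡1
    , (λ {x} p → u * x , uI⊆J (x , p , refl) , sym (cancel v u vu≡1 x))
    , vJ⊆I
    where
    vu≡1 : v * u ≡ 1K
    vu≡1 = trans (*-comm v u) uv≡1

    vJ⊆I : ∀ {x} → (v · Member J) x → Member I x
    vJ⊆I (y , q , refl) with J⊆uI q
    ... | x , p , refl = subst (Member I) (sym (cancel v u vu≡1 x)) p

  ∼-trans : ∀ {I J L} → I ∼ J → J ∼ L → I ∼ L
  ∼-trans {I} {J} {L} (u , v , uv≡1 , J⊆uI , uI⊆J) (u′ , v′ , u′v′≡1 , L⊆u′J , u′J⊆L) =
    u′ * u , v * v′
    , trans (*-assoc u′ u (v * v′)) (trans (cong (u′ *_) (cancel u v uv≡1 v′)) u′v′≡1)
    , L⊆u′uI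
    , λ { (y , p , refl) → u′J⊆L (u * y , uI⊆J (y , p , refl) , *-assoc u′ u y) }
    where
    L⊆u′uI : ∀ {x} → Member L x → ((u′ * u) · Member I) x
    L⊆u′uI q with L⊆u′J q
    ... | y , r , refl with J⊆uI r
    ... | z , p , refl = z , p , sym (*-assoc u′ u z)

  ∼-isEquivalence : IsEquivalence _∼_
  ∼-isEquivalence = record
    { refl  = λ {I} → ∼-refl {I}
    ; sym   = λ {I} {J} → ∼-sym {I} {J}
    ; trans = λ {I} {J} {L} → ∼-trans {I} {J} {L}
    }

  -- The class group as a set; its order does not involve the multiplication.
  ClassGroup : Setoid 0ℓ 0ℓ
  ClassGroup = record { isEquivalence = ∼-isEquivalence }

-- h is the class number of ℚ(√d).  A relation rather than a function, so that no
-- proof of finiteness of the class group is needed to state it.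
IsClassNumber : ℕ → ℕ → Set
IsClassNumber d h = Bijection (setoid (Fin h)) (QuadraticField.ClassGroup d)

module Submission where

-- Put n = 4bs + 1, N = n^k and a = bN + s, so D = a² + N.  Let p be a prime factor of n with
-- p² ≤ n.  As D ≡ s² (mod p), the ideal (p, s + √D) has norm p; if h(D) = 1, a generator
-- yields integers with x² − D y² = ±4p.  On the other hand, the reduction cycle of the
-- principal form of discriminant 4D consists, up to sign, of
--   n^i u² + 2a uv − n^(k−i) v²   and   n^(k−i) u² + 2(bN − s) uv − n^(i+1) v²,
-- and inside the cone where no reduction step applies their values are n^i u² or at least n.
-- So x² − D y² = ±m with m < n forces m to be a square.  This contradicts 4p < n, which
-- holds except for n = 9, where D ≡ 2 (mod 4) allows replacing 4p by p.

-- The norm of a generator `u` is pinned down as follows. Every element of the ideal has norm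
-- divisible by p, and p is a multiple of `u`, so the norm of `u` is ±p or ±p². The latter would
-- make the cofactor p / u have norm ±1, so p would divide s + √D and hence its trace 2s; but p
-- divides 4bs + 1. The extra factor 4 comes from the ring of integers, which can contain elements
-- with half-integer coordinates.
--
-- The algebraic obstacle is that integrality is given by monic polynomials, while the argument
-- needs norms and traces of integral elements to be integers. Integrality is therefore weakened to
-- a common denominator for all powers, a property that passes to sums, products and conjugates by
-- direct computation and that forces a rational number to be an integer.
--
-- The claim about small values is a Euclidean descent on pairs (u, v) of naturals. A reduction step
-- subtracts a multiple of u from v, exchanges the two and passes to the next form of the cycle with
-- the opposite sign. Absolute values absorb the sign.

open import Defs
open import Algebra.Bundles using (CommutativeRing; CommutativeSemiring)
import Algebra.Properties.CommutativeSemiring.Exp as Exp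
import Algebra.Solver.Ring.NaturalCoefficients.Default as NaturalSolver
open import Data.Fin.Base using (Fin)
open import Data.Integer.Base as ℤ using (ℤ; +_; -[1+_]; ∣_∣)
import Data.Integer.Properties as ℤ
import Data.Integer.Tactic.RingSolver as ℤ-Solver
open import Data.List.Base using ([]; _∷_; length)
open import Data.List.Relation.Unary.All using (_∷_)
open import Data.List.Relation.Unary.Any using (here)
open import Data.Nat.Base as ℕ using (ℕ; zero; suc; z≤n; s≤s; ∣_-_∣)
open import Data.Nat.Coprimality as Coprimality using (Coprime; coprime-divisor)
open import Data.Nat.Divisibility
open import Data.Nat.Induction using (<-wellFounded)
open import Data.Nat.Primality
open import Data.Nat.Primality.Factorisation using (factorise)
import Data.Nat.Properties as ℕ
open import Data.Nat.Tactic.RingSolver using (solve-∀)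
open import Data.Product.Base using (∃; ∃₂; _×_; _,_)
open import Data.Rational.Base as ℚ using (ℚ; mkℚ; 0ℚ; 1ℚ; ↥_; ↧_; ↧ₙ_; toℚᵘ)
import Data.Rational.Properties as ℚ
open import Data.Rational.Solver using (module +-*-Solver)
open import Data.Rational.Unnormalised.Base as ℚᵘ using (mkℚᵘ; *≡*) renaming (_≃_ to _≃ᵘ_)
import Data.Rational.Unnormalised.Properties as ℚᵘ
open import Data.Sum.Base using (_⊎_; inj₁; inj₂; [_,_]′)
open import Function.Base using (id)
open import Function.Bundles using (module Bijection)
open import Induction.WellFounded using (Acc; acc)
open import Level using (0ℓ)
open import Relation.Binary.PropositionalEquality
open import Relation.Binary.PropositionalEquality.Algebra using (isMagma)
open import Relation.Nullary using (¬_; contradiction; yes; no)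

-- Integers among the rationals

toℚᵘ-fromℤ : ∀ i → toℚᵘ (fromℤ i) ≃ᵘ mkℚᵘ i 0
toℚᵘ-fromℤ i = ℚ.toℚᵘ-fromℚᵘ (mkℚᵘ i 0)

fromℤ-injective : ∀ {i j} → fromℤ i ≡ fromℤ j → i ≡ j
fromℤ-injective {i} {j} eq
  with *≡* e ← ℚᵘ.≃-trans (ℚᵘ.≃-sym (toℚᵘ-fromℤ i))
                 (ℚᵘ.≃-trans (ℚ.toℚᵘ-cong eq) (toℚᵘ-fromℤ j))
  = trans (sym (ℤ.*-identityʳ i)) (trans e (ℤ.*-identityʳ j))

fromℤ-homo-+ : ∀ i j → fromℤ (i ℤ.+ j) ≡ fromℤ i ℚ.+ fromℤ j
fromℤ-homo-+ i j = ℚ.toℚᵘ-injective (begin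
  toℚᵘ (fromℤ (i ℤ.+ j))                ≈⟨ toℚᵘ-fromℤ (i ℤ.+ j) ⟩
  mkℚᵘ (i ℤ.+ j) 0                      ≈⟨ *≡* (lem i j) ⟩
  mkℚᵘ i 0 ℚᵘ.+ mkℚᵘ j 0                ≈⟨ ℚᵘ.+-cong (toℚᵘ-fromℤ i) (toℚᵘ-fromℤ j) ⟨
  toℚᵘ (fromℤ i) ℚᵘ.+ toℚᵘ (fromℤ j)    ≈⟨ ℚ.toℚᵘ-homo-+ (fromℤ i) (fromℤ j) ⟨
  toℚᵘ (fromℤ i ℚ.+ fromℤ j)            ∎)
  where
  open ℚᵘ.≃-Reasoning
  lem : ∀ i j → (i ℤ.+ j) ℤ.* + 1 ≡ (i ℤ.* + 1 ℤ.+ j ℤ.* + 1) ℤ.* + 1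
  lem = ℤ-Solver.solve-∀

fromℤ-homo-* : ∀ i j → fromℤ (i ℤ.* j) ≡ fromℤ i ℚ.* fromℤ j
fromℤ-homo-* i j = ℚ.toℚᵘ-injective (begin
  toℚᵘ (fromℤ (i ℤ.* j))                ≈⟨ toℚᵘ-fromℤ (i ℤ.* j) ⟩
  mkℚᵘ i 0 ℚᵘ.* mkℚᵘ j 0                ≈⟨ ℚᵘ.*-cong (toℚᵘ-fromℤ i) (toℚᵘ-fromℤ j) ⟨
  toℚᵘ (fromℤ i) ℚᵘ.* toℚᵘ (fromℤ j)    ≈⟨ ℚ.toℚᵘ-homo-* (fromℤ i) (fromℤ j) ⟨
  toℚᵘ (fromℤ i ℚ.* fromℤ j)            ∎)
  where open ℚᵘ.≃-Reasoning

fromℤ-homo-neg : ∀ i → fromℤ (ℤ.- i) ≡ ℚ.- fromℤ i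
fromℤ-homo-neg i = ℚ.toℚᵘ-injective (begin
  toℚᵘ (fromℤ (ℤ.- i))      ≈⟨ toℚᵘ-fromℤ (ℤ.- i) ⟩
  ℚᵘ.- mkℚᵘ i 0             ≈⟨ ℚᵘ.-‿cong (toℚᵘ-fromℤ i) ⟨
  ℚᵘ.- toℚᵘ (fromℤ i)       ≈⟨ ℚ.toℚᵘ-homo‿- (fromℤ i) ⟨
  toℚᵘ (ℚ.- fromℤ i)        ∎)
  where open ℚᵘ.≃-Reasoning

x*↧x≡↥x : ∀ x → x ℚ.* fromℤ (↧ x) ≡ fromℤ (↥ x)
x*↧x≡↥x x@(mkℚ n d-1 _) = ℚ.toℚᵘ-injective (begin
  toℚᵘ (x ℚ.* fromℤ (↧ x))            ≈⟨ ℚ.toℚᵘ-homo-* x (fromℤ (↧ x)) ⟩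
  toℚᵘ x ℚᵘ.* toℚᵘ (fromℤ (↧ x))      ≈⟨ ℚᵘ.*-congˡ {toℚᵘ x} (toℚᵘ-fromℤ (↧ x)) ⟩
  toℚᵘ x ℚᵘ.* mkℚᵘ (↧ x) 0            ≈⟨ *≡* lem ⟩
  mkℚᵘ n 0                            ≈⟨ toℚᵘ-fromℤ n ⟨
  toℚᵘ (fromℤ n)                      ∎)
  where
  open ℚᵘ.≃-Reasoning
  lem : n ℤ.* + suc d-1 ℤ.* + 1 ≡ n ℤ.* + (suc d-1 ℕ.* 1)
  lem = trans (ℤ.*-identityʳ _) (cong (λ d → n ℤ.* + d) (sym (ℕ.*-identityʳ _)))

IsInteger : ℚ → Set
IsInteger x = ∃ λ i → x ≡ fromℤ i

IsInteger-+ : ∀ {x y} → IsInteger x → IsInteger y → IsInteger (x ℚ.+ y)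
IsInteger-+ (i , refl) (j , refl) = i ℤ.+ j , sym (fromℤ-homo-+ i j)

IsInteger-* : ∀ {x y} → IsInteger x → IsInteger y → IsInteger (x ℚ.* y)
IsInteger-* (i , refl) (j , refl) = i ℤ.* j , sym (fromℤ-homo-* i j)

IsInteger-neg : ∀ {x} → IsInteger x → IsInteger (ℚ.- x)
IsInteger-neg (i , refl) = ℤ.- i , sym (fromℤ-homo-neg i)

coprime-* : ∀ {a b c} → Coprime a c → Coprime b c → Coprime (a ℕ.* b) c
coprime-* {a} {b} {c} ac bc {d} (d∣ab , d∣c) = bc (coprime-divisor da d∣ab , d∣c)
  where
  da : Coprime d a
  da (e∣d , e∣a) = ac (e∣a , ∣-trans e∣d d∣c)

coprime-^ : ∀ {a c} j → Coprime a c → Coprime (a ℕ.^ j) c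
coprime-^ zero    ac (d∣1 , _) = ∣1⇒≡1 d∣1
coprime-^ {a} {c} (suc j) ac = coprime-* {a} {a ℕ.^ j} {c} ac (coprime-^ j ac)

open Exp (CommutativeRing.commutativeSemiring ℚ.+-*-commutativeRing) using ()
  renaming (_^_ to _^ℚ_; ^-distrib-* to ^ℚ-distrib-*)

fromℤ-homo-^ : ∀ i j → fromℤ (i ℤ.^ j) ≡ fromℤ i ^ℚ j
fromℤ-homo-^ i zero    = refl
fromℤ-homo-^ i (suc j) = trans (fromℤ-homo-* i (i ℤ.^ j)) (cong (fromℤ i ℚ.*_) (fromℤ-homo-^ i j))

abs-^ : ∀ i j → ∣ i ℤ.^ j ∣ ≡ ∣ i ∣ ℕ.^ j
abs-^ i zero    = refl
abs-^ i (suc j) = trans (ℤ.abs-* i (i ℤ.^ j)) (cong (∣ i ∣ ℕ.*_) (abs-^ i j))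

-- The powers of the reduced numerator and denominator stay coprime, so the denominator of `x ^ j`
-- can only be cancelled by `M`.
↧^∣ : ∀ M x j → IsInteger (fromℤ (+ M) ℚ.* x ^ℚ j) → (↧ₙ x) ℕ.^ j ∣ M
↧^∣ M x@(mkℚ n d-1 c) j (i , eq) = coprime-divisor coprime (divides ∣ i ∣ (begin
  ∣ n ∣ ℕ.^ j ℕ.* M                ≡⟨ ℕ.*-comm _ M ⟩
  M ℕ.* ∣ n ∣ ℕ.^ j                ≡⟨ cong (M ℕ.*_) (abs-^ n j) ⟨
  M ℕ.* ∣ n ℤ.^ j ∣                ≡⟨ ℤ.abs-* (+ M) (n ℤ.^ j) ⟨
  ∣ + M ℤ.* n ℤ.^ j ∣              ≡⟨ cong ∣_∣ eqℤ ⟩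
  ∣ i ℤ.* (↧ x) ℤ.^ j ∣            ≡⟨ ℤ.abs-* i ((↧ x) ℤ.^ j) ⟩
  ∣ i ∣ ℕ.* ∣ (↧ x) ℤ.^ j ∣        ≡⟨ cong (∣ i ∣ ℕ.*_) (abs-^ (↧ x) j) ⟩
  ∣ i ∣ ℕ.* suc d-1 ℕ.^ j          ∎))
  where
  open ≡-Reasoning
  coprime : Coprime (suc d-1 ℕ.^ j) (∣ n ∣ ℕ.^ j)
  coprime = Coprimality.sym (coprime-^ j (Coprimality.sym (coprime-^ j (Coprimality.sym (Coprimality.recompute c)))))
  eqℤ : + M ℤ.* n ℤ.^ j ≡ i ℤ.* (↧ x) ℤ.^ j
  eqℤ = fromℤ-injective (begin
    fromℤ (+ M ℤ.* n ℤ.^ j)                       ≡⟨ fromℤ-homo-* (+ M) _ ⟩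
    fromℤ (+ M) ℚ.* fromℤ (n ℤ.^ j)               ≡⟨ cong (fromℤ (+ M) ℚ.*_) (fromℤ-homo-^ n j) ⟩
    fromℤ (+ M) ℚ.* fromℤ n ^ℚ j                  ≡⟨ cong (λ y → fromℤ (+ M) ℚ.* y ^ℚ j) (x*↧x≡↥x x) ⟨
    fromℤ (+ M) ℚ.* (x ℚ.* fromℤ (↧ x)) ^ℚ j      ≡⟨ cong (fromℤ (+ M) ℚ.*_) (^ℚ-distrib-* x (fromℤ (↧ x)) j) ⟩
    fromℤ (+ M) ℚ.* (x ^ℚ j ℚ.* fromℤ (↧ x) ^ℚ j) ≡⟨ ℚ.*-assoc (fromℤ (+ M)) _ _ ⟨
    fromℤ (+ M) ℚ.* x ^ℚ j ℚ.* fromℤ (↧ x) ^ℚ j   ≡⟨ cong₂ ℚ._*_ eq (sym (fromℤ-homo-^ (↧ x) j)) ⟩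
    fromℤ i ℚ.* fromℤ ((↧ x) ℤ.^ j)               ≡⟨ fromℤ-homo-* i _ ⟨
    fromℤ (i ℤ.* (↧ x) ℤ.^ j)                     ∎)

↧≡1⇒IsInteger : ∀ x → ↧ₙ x ≡ 1 → IsInteger x
↧≡1⇒IsInteger x eq = ↥ x , trans (sym (ℚ.*-identityʳ x))
  (trans (cong (λ q → x ℚ.* fromℤ (+ q)) (sym eq)) (x*↧x≡↥x x))

-- A denominator q ≥ 2 would give q^M ∣ M although q^M > M.
boundedPowers⇒IsInteger : ∀ M .{{_ : ℕ.NonZero M}} x →
  (∀ j → IsInteger (fromℤ (+ M) ℚ.* x ^ℚ j)) → IsInteger x
boundedPowers⇒IsInteger M x h = ↧≡1⇒IsInteger x (go (↧ₙ x) (↧^∣ M x M (h M)))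
  where
  m<[2+q]^m : ∀ q m → m ℕ.< (2 ℕ.+ q) ℕ.^ m
  m<[2+q]^m q zero    = ℕ.s≤s ℕ.z≤n
  m<[2+q]^m q (suc m) = begin-strict
    suc m                                  ≤⟨ m<[2+q]^m q m ⟩
    (2 ℕ.+ q) ℕ.^ m                        <⟨ ℕ.m<m+n _ (ℕ.≤-<-trans ℕ.z≤n (m<[2+q]^m q m)) ⟩
    (2 ℕ.+ q) ℕ.^ m ℕ.+ (2 ℕ.+ q) ℕ.^ m    ≤⟨ ℕ.+-monoʳ-≤ ((2 ℕ.+ q) ℕ.^ m) (ℕ.m≤m+n ((2 ℕ.+ q) ℕ.^ m) _) ⟩
    (2 ℕ.+ q) ℕ.^ suc m                    ∎
    where open ℕ.≤-Reasoning
  go : ∀ q .{{_ : ℕ.NonZero q}} → q ℕ.^ M ∣ M → q ≡ 1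
  go 1             _ = refl
  go (suc (suc q)) d = contradiction (∣⇒≤ d) (ℕ.<⇒≱ (m<[2+q]^m q M))

-- By `↧^∣` with exponent 2, the square of the denominator of `x` divides `d`.
squarefree-IsInteger : ∀ {d} → Squarefree d → ∀ x → IsInteger (fromℤ (+ d) ℚ.* (x ℚ.* x)) → IsInteger x
squarefree-IsInteger {d} sf x (i , eq) = ↧≡1⇒IsInteger x (sf (↧ₙ x)
  (subst (_∣ d) (cong (↧ₙ x ℕ.*_) (ℕ.*-identityʳ (↧ₙ x)))
    (↧^∣ d x 2 (i , trans (cong (λ y → fromℤ (+ d) ℚ.* (x ℚ.* y)) (ℚ.*-identityʳ x)) eq))))

-- Quadratic integers

-- Solving these identities directly in ℚ[√ d ] would unfold its operations.
module SemiringIdentities {c ℓ} (R : CommutativeSemiring c ℓ) where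

  open CommutativeSemiring R using (_≈_; _+_; _*_; 1#) renaming (refl to ≈-refl)
  open NaturalSolver R

  [wx][yz]≈[wy][xz] : ∀ w x y z → (w * x) * (y * z) ≈ (w * y) * (x * z)
  [wx][yz]≈[wy][xz] = solve 4 (λ w x y z → (w :* x) :* (y :* z) := (w :* y) :* (x :* z)) ≈-refl

  binomialStep : ∀ m x y a b z →
    m * ((a * x) * (y * z)) + m * (x * ((b * y) * z)) ≈ m * (x * (y * ((a + b) * z)))
  binomialStep = solve 6 (λ m x y a b z →
    m :* ((a :* x) :* (y :* z)) :+ m :* (x :* ((b :* y) :* z))
      := m :* (x :* (y :* ((a :+ b) :* z)))) ≈-refl

  hornerStep : ∀ z c a e → z * (c + a * e) ≈ z * 1# * c + z * a * e
  hornerStep = solve 4 (λ z c a e →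
    z :* (c :+ a :* e) := z :* con 1 :* c :+ z :* a :* e) ≈-refl

module AlmostIntegral (d : ℕ) where

  open QuadraticField d

  infix 8 -_
  -_ : K → K
  - (x +√ y) = ℚ.- x +√ ℚ.- y

  K-commutativeSemiring : CommutativeSemiring 0ℓ 0ℓ
  K-commutativeSemiring = record
    { Carrier = K ; _≈_ = _≡_ ; _+_ = _+_ ; _*_ = _*_ ; 0# = 0K ; 1# = 1K
    ; isCommutativeSemiring = record
      { isSemiring = record
        { isSemiringWithoutAnnihilatingZero = record
          { +-isCommutativeMonoid = record
            { isMonoid = record
              { isSemigroup = record
                { isMagma = isMagma _+_
                ; assoc = λ { (a +√ b) (a′ +√ b′) (a″ +√ b″) →
                    cong₂ _+√_ (ℚ.+-assoc a a′ a″) (ℚ.+-assoc b b′ b″) }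
                }
              ; identity = (λ { (a +√ b) → cong₂ _+√_ (ℚ.+-identityˡ a) (ℚ.+-identityˡ b) })
                         , (λ { (a +√ b) → cong₂ _+√_ (ℚ.+-identityʳ a) (ℚ.+-identityʳ b) })
              }
            ; comm = λ { (a +√ b) (a′ +√ b′) → cong₂ _+√_ (ℚ.+-comm a a′) (ℚ.+-comm b b′) }
            }
          ; *-cong = cong₂ _*_
          ; *-assoc = *-assoc
          ; *-identity = *-identityˡ , λ x → trans (*-comm x 1K) (*-identityˡ x)
          ; distrib = distribˡ , λ x y z → trans (*-comm (y + z) x)
              (trans (distribˡ x y z) (cong₂ _+_ (*-comm x y) (*-comm x z)))
          }
        ; zero = zeroˡ , λ x → trans (*-comm x 0K) (zeroˡ x)
        }
      ; *-comm = *-comm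
      }
    }
    where
    open +-*-Solver
    distribˡ : ∀ x y z → x * (y + z) ≡ x * y + x * z
    distribˡ (a +√ b) (a′ +√ b′) (a″ +√ b″) = cong₂ _+√_
      (solve 7 (λ a b a′ b′ a″ b″ e → a :* (a′ :+ a″) :+ e :* (b :* (b′ :+ b″))
        := a :* a′ :+ e :* (b :* b′) :+ (a :* a″ :+ e :* (b :* b″))) refl a b a′ b′ a″ b″ e)
      (solve 6 (λ a b a′ b′ a″ b″ → a :* (b′ :+ b″) :+ b :* (a′ :+ a″)
        := a :* b′ :+ b :* a′ :+ (a :* b″ :+ b :* a″)) refl a b a′ b′ a″ b″)
      where e = fromℤ (+ d)
    zeroˡ : ∀ x → 0K * x ≡ 0K
    zeroˡ (a +√ b) = cong₂ _+√_
      (solve 3 (λ a b e → con 0ℚ :* a :+ e :* (con 0ℚ :* b) := con 0ℚ) refl a b (fromℤ (+ d)))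
      (solve 2 (λ a b → con 0ℚ :* b :+ con 0ℚ :* a := con 0ℚ) refl a b)

  open CommutativeSemiring K-commutativeSemiring
    using (*-identityʳ; zeroʳ)
  open Exp K-commutativeSemiring using (_^_; ^-distrib-*)
  open SemiringIdentities K-commutativeSemiring

  rational : ℚ → K
  rational x = x +√ 0ℚ

  ⌊_⌋ : ℕ → K
  ⌊ n ⌋ = rational (fromℤ (+ n))

  rational-* : ∀ x y → rational (x ℚ.* y) ≡ rational x * rational y
  rational-* x y = cong₂ _+√_
    (solve 3 (λ x y e → x :* y := x :* y :+ e :* (con 0ℚ :* con 0ℚ)) refl x y (fromℤ (+ d)))
    (solve 2 (λ x y → con 0ℚ := x :* con 0ℚ :+ con 0ℚ :* y) refl x y)
    where open +-*-Solver

  rational-^ : ∀ x j → rational (x ^ℚ j) ≡ rational x ^ j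
  rational-^ x zero    = refl
  rational-^ x (suc j) = trans (rational-* x (x ^ℚ j)) (cong (rational x *_) (rational-^ x j))

  ⌊⌋-homo-* : ∀ m n → ⌊ m ℕ.* n ⌋ ≡ ⌊ m ⌋ * ⌊ n ⌋
  ⌊⌋-homo-* m n = trans
    (cong rational (trans (cong fromℤ (ℤ.pos-* m n)) (fromℤ-homo-* (+ m) (+ n))))
    (rational-* (fromℤ (+ m)) (fromℤ (+ n)))

  -- This may be smaller than the ring of integers.
  record ℤ[√d] (α : K) : Set where
    constructor _,′_
    field
      rat-integer  : IsInteger (ℚ[√_].rat α)
      surd-integer : IsInteger (ℚ[√_].surd α)

  open ℤ[√d]

  ℤ[√d]-+ : ∀ {α β} → ℤ[√d] α → ℤ[√d] β → ℤ[√d] (α + β)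
  ℤ[√d]-+ (x ,′ y) (x′ ,′ y′) = IsInteger-+ x x′ ,′ IsInteger-+ y y′

  ℤ[√d]-neg : ∀ {α} → ℤ[√d] α → ℤ[√d] (- α)
  ℤ[√d]-neg (x ,′ y) = IsInteger-neg x ,′ IsInteger-neg y

  ℤ[√d]-* : ∀ {α β} → ℤ[√d] α → ℤ[√d] β → ℤ[√d] (α * β)
  ℤ[√d]-* (x ,′ y) (x′ ,′ y′) =
    IsInteger-+ (IsInteger-* x x′) (IsInteger-* (+ d , refl) (IsInteger-* y y′)) ,′
    IsInteger-+ (IsInteger-* x y′) (IsInteger-* y x′)

  ℤ[√d]-^ : ∀ {α} j → ℤ[√d] α → ℤ[√d] (α ^ j)
  ℤ[√d]-^ zero    h = (+ 1 , refl) ,′ (+ 0 , refl)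
  ℤ[√d]-^ (suc j) h = ℤ[√d]-* h (ℤ[√d]-^ j h)

  ℤ[√d]-rational : ∀ {x} → IsInteger x → ℤ[√d] (rational x)
  ℤ[√d]-rational h = h ,′ (+ 0 , refl)

  ℤ[√d]-cancelʳ : ∀ {α β} → ℤ[√d] (α + β) → ℤ[√d] α → ℤ[√d] β
  ℤ[√d]-cancelʳ {α@(a +√ b)} {β@(a′ +√ b′)} h hα = subst ℤ[√d] eq (ℤ[√d]-+ h (ℤ[√d]-neg hα))
    where
    open +-*-Solver
    lem : ∀ a a′ → a ℚ.+ a′ ℚ.+ ℚ.- a ≡ a′
    lem = solve 2 (λ a a′ → a :+ a′ :+ :- a := a′) refl
    eq : α + β + - α ≡ β
    eq = cong₂ _+√_ (lem a a′) (lem b b′)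

  -- Equivalent to integrality because ℤ[√d] is Noetherian, but with elementary closure
  -- properties.
  AlmostIntegral : K → Set
  AlmostIntegral α = ∃ λ M → ℕ.NonZero M × (∀ j → ℤ[√d] (⌊ M ⌋ * α ^ j))

  AlmostIntegral-ℤ[√d] : ∀ {α} → ℤ[√d] α → AlmostIntegral α
  AlmostIntegral-ℤ[√d] h = 1 , _ , λ j → ℤ[√d]-* (ℤ[√d]-rational (+ 1 , refl)) (ℤ[√d]-^ j h)

  AlmostIntegral-* : ∀ {α β} → AlmostIntegral α → AlmostIntegral β → AlmostIntegral (α * β)
  AlmostIntegral-* {α} {β} (M , M≢0 , h) (M′ , M′≢0 , h′) =
    M ℕ.* M′ , ℕ.m*n≢0 M M′ {{M≢0}} {{M′≢0}} , λ j → subst ℤ[√d] (eq j) (ℤ[√d]-* (h j) (h′ j))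
    where
    eq : ∀ j → (⌊ M ⌋ * α ^ j) * (⌊ M′ ⌋ * β ^ j) ≡ ⌊ M ℕ.* M′ ⌋ * (α * β) ^ j
    eq j = trans
      ([wx][yz]≈[wy][xz] ⌊ M ⌋ (α ^ j) ⌊ M′ ⌋ (β ^ j))
      (cong₂ _*_ (sym (⌊⌋-homo-* M M′)) (sym (^-distrib-* α β j)))

  AlmostIntegral-+ : ∀ {α β} → AlmostIntegral α → AlmostIntegral β → AlmostIntegral (α + β)
  AlmostIntegral-+ {α} {β} (M , M≢0 , h) (M′ , M′≢0 , h′) =
    M ℕ.* M′ , ℕ.m*n≢0 M M′ {{M≢0}} {{M′≢0}} , λ j →
      subst ℤ[√d] (trans (cong (_* (1K * (1K * (α + β) ^ j))) (sym (⌊⌋-homo-* M M′)))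
                    (cong (⌊ M ℕ.* M′ ⌋ *_) (trans (*-identityˡ _) (*-identityˡ _))))
        (go j 0 0)
    where
    -- The product of the two denominators clears every monomial in α and β. A factor α + β is
    -- expanded one at a time into the exponents `i` and `j`, so no binomial coefficients appear.
    go : ∀ n i j → ℤ[√d] ((⌊ M ⌋ * ⌊ M′ ⌋) * (α ^ i * (β ^ j * (α + β) ^ n)))
    go zero i j = subst ℤ[√d]
      (trans ([wx][yz]≈[wy][xz] ⌊ M ⌋ (α ^ i) ⌊ M′ ⌋ (β ^ j))
        (cong (λ z → (⌊ M ⌋ * ⌊ M′ ⌋) * (α ^ i * z)) (sym (*-identityʳ (β ^ j)))))
      (ℤ[√d]-* (h i) (h′ j))
    go (suc n) i j = subst ℤ[√d]
      (binomialStep (⌊ M ⌋ * ⌊ M′ ⌋) (α ^ i) (β ^ j) α β ((α + β) ^ n))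
      (ℤ[√d]-+ (go n (suc i) j) (go n i (suc j)))

  clearDenominators : ∀ α → ∃ λ q → ℕ.NonZero q × ℤ[√d] (⌊ q ⌋ * α)
  clearDenominators (x +√ y) = ↧ₙ x ℕ.* ↧ₙ y , ℕ.m*n≢0 (↧ₙ x) (↧ₙ y) ,
    subst ℤ[√d] eq
      ( IsInteger-* (↥ x , x*↧x≡↥x x) (↧ y , refl)
      ,′ IsInteger-* (↥ y , x*↧x≡↥x y) (↧ x , refl))
    where
    open +-*-Solver
    eq : (x ℚ.* fromℤ (↧ x) ℚ.* fromℤ (↧ y) +√ y ℚ.* fromℤ (↧ y) ℚ.* fromℤ (↧ x))
       ≡ ⌊ ↧ₙ x ℕ.* ↧ₙ y ⌋ * (x +√ y)
    eq = trans (cong₂ _+√_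
      (solve 5 (λ x y p q e → x :* p :* q := p :* q :* x :+ e :* (con 0ℚ :* y)) refl
        x y (fromℤ (↧ x)) (fromℤ (↧ y)) (fromℤ (+ d)))
      (solve 4 (λ x y p q → y :* q :* p := p :* q :* y :+ con 0ℚ :* x) refl
        x y (fromℤ (↧ x)) (fromℤ (↧ y))))
      (cong (λ z → rational z * (x +√ y)) (sym (trans
        (cong fromℤ (ℤ.pos-* (↧ₙ x) (↧ₙ y))) (fromℤ-homo-* (↧ x) (↧ y)))))

  -- The i-th power of α needs only the i-th power of `q`, so a single `q ^ m` serves all exponents
  -- up to `m`.
  clearPowers : ∀ q α → ℤ[√d] (⌊ q ⌋ * α) → ∀ m i → i ℕ.≤ m → ℤ[√d] (⌊ q ℕ.^ m ⌋ * α ^ i)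
  clearPowers q α h m zero _ = ℤ[√d]-* (ℤ[√d]-rational (+ (q ℕ.^ m) , refl)) ((+ 1 , refl) ,′ (+ 0 , refl))
  clearPowers q α h (suc m) (suc i) (s≤s i≤m) = subst ℤ[√d] (trans
      ([wx][yz]≈[wy][xz] ⌊ q ⌋ α ⌊ q ℕ.^ m ⌋ (α ^ i))
      (cong (_* α ^ suc i) (sym (⌊⌋-homo-* q (q ℕ.^ m)))))
    (ℤ[√d]-* h (clearPowers q α h m i i≤m))

  -- All terms of the polynomial except the leading one are known to lie in ℤ[√d], so they can be
  -- subtracted. Each Horner step removes the constant term and moves a factor α into `z`.
  leadingPower : ∀ α cs z → (∀ i → i ℕ.< length cs → ℤ[√d] (z * α ^ i)) →
                 ℤ[√d] (z * evalMonic cs α) → ℤ[√d] (z * α ^ length cs)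
  leadingPower α []       z _   hz = hz
  leadingPower α (c ∷ cs) z low hz =
    subst ℤ[√d] (*-assoc z α (α ^ length cs)) (leadingPower α cs (z * α)
      (λ i i<m → subst ℤ[√d] (sym (*-assoc z α (α ^ i))) (low (suc i) (s≤s i<m)))
      (ℤ[√d]-cancelʳ
        (subst ℤ[√d]
          (hornerStep z (rational (fromℤ c)) α (evalMonic cs α))
          hz)
        (ℤ[√d]-* (low 0 (s≤s z≤n)) (ℤ[√d]-rational (c , refl)))))

  -- The equation of α expresses each power through the preceding ones. Replacing `z` by `z * α`
  -- slides the window of known powers up by one: the old entries give all but the top, and
  -- `leadingPower` supplies that one.
  powersFromWindow : ∀ α cs → evalMonic cs α ≡ 0K → ∀ j z →
    (∀ i → i ℕ.≤ length cs → ℤ[√d] (z * α ^ i)) → ℤ[√d] (z * α ^ j)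
  powersFromWindow α cs root zero    z h = h 0 z≤n
  powersFromWindow α cs root (suc j) z h =
    subst ℤ[√d] (*-assoc z α (α ^ j)) (powersFromWindow α cs root j (z * α) shifted)
    where
    below : ∀ i → i ℕ.< length cs → ℤ[√d] (z * α * α ^ i)
    below i i<m = subst ℤ[√d] (sym (*-assoc z α (α ^ i))) (h (suc i) i<m)
    vanishing : z * α * evalMonic cs α ≡ 0K
    vanishing = trans (cong (z * α *_) root) (zeroʳ (z * α))
    top : ℤ[√d] (z * α * α ^ length cs)
    top = leadingPower α cs (z * α) below
      (subst ℤ[√d] (sym vanishing) (ℤ[√d]-rational (+ 0 , refl)))
    shifted : ∀ i → i ℕ.≤ length cs → ℤ[√d] (z * α * α ^ i)
    shifted i i≤m = [ below i , (λ i≡m → subst (λ i → ℤ[√d] (z * α * α ^ i)) (sym i≡m) top) ]′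
      (ℕ.m≤n⇒m<n∨m≡n i≤m)

  Integral⇒AlmostIntegral : ∀ {α} → Integral α → AlmostIntegral α
  Integral⇒AlmostIntegral {α} (cs , root) =
    let q , q≢0 , hq = clearDenominators α in
    q ℕ.^ length cs , ℕ.m^n≢0 q (length cs) {{q≢0}} ,
    λ j → powersFromWindow α cs root j ⌊ q ℕ.^ length cs ⌋ (clearPowers q α hq (length cs))

  -- A fixed `M` clearing all powers of a rational number is exactly the hypothesis of
  -- `boundedPowers⇒IsInteger`.
  AlmostIntegral-rational : ∀ {x} → AlmostIntegral (rational x) → IsInteger x
  AlmostIntegral-rational {x} (M , M≢0 , h) = boundedPowers⇒IsInteger M {{M≢0}} x λ j →
    rat-integer (subst ℤ[√d] (sym (trans (rational-* (fromℤ (+ M)) (x ^ℚ j)) (cong (⌊ M ⌋ *_) (rational-^ x j)))) (h j))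

  -- Conjugates, norms and traces

  conj : K → K
  conj (x +√ y) = x +√ ℚ.- y

  conj-* : ∀ α β → conj (α * β) ≡ conj α * conj β
  conj-* (a +√ b) (a′ +√ b′) = cong₂ _+√_
    (solve 5 (λ a b a′ b′ e → a :* a′ :+ e :* (b :* b′) := a :* a′ :+ e :* (:- b :* :- b′))
      refl a b a′ b′ (fromℤ (+ d)))
    (solve 4 (λ a b a′ b′ → :- (a :* b′ :+ b :* a′) := a :* :- b′ :+ :- b :* a′) refl a b a′ b′)
    where open +-*-Solver

  conj-^ : ∀ α j → conj (α ^ j) ≡ conj α ^ j
  conj-^ α zero    = refl
  conj-^ α (suc j) = trans (conj-* α (α ^ j)) (cong (conj α *_) (conj-^ α j))

  AlmostIntegral-conj : ∀ {α} → AlmostIntegral α → AlmostIntegral (conj α)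
  AlmostIntegral-conj {α} (M , M≢0 , h) = M , M≢0 , λ j →
    subst ℤ[√d] (trans (conj-* ⌊ M ⌋ (α ^ j)) (cong (⌊ M ⌋ *_) (conj-^ α j)))
      (rat-integer (h j) ,′ IsInteger-neg (surd-integer (h j)))

  norm trace : K → ℚ
  norm  (x +√ y) = x ℚ.* x ℚ.- fromℤ (+ d) ℚ.* (y ℚ.* y)
  trace (x +√ y) = x ℚ.+ x

  α*conj : ∀ α → α * conj α ≡ rational (norm α)
  α*conj (x +√ y) = cong₂ _+√_
    (solve 3 (λ x y e → x :* x :+ e :* (y :* :- y) := x :* x :- e :* (y :* y)) refl x y (fromℤ (+ d)))
    (solve 2 (λ x y → x :* :- y :+ y :* x := con 0ℚ) refl x y)
    where open +-*-Solver

  α+conj : ∀ α → α + conj α ≡ rational (trace α)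
  α+conj (x +√ y) = cong (x ℚ.+ x +√_) (ℚ.+-inverseʳ y)

  norm-* : ∀ α β → norm (α * β) ≡ norm α ℚ.* norm β
  norm-* (a +√ b) (a′ +√ b′) = solve 5 (λ a b a′ b′ e →
      (a :* a′ :+ e :* (b :* b′)) :* (a :* a′ :+ e :* (b :* b′))
        :- e :* ((a :* b′ :+ b :* a′) :* (a :* b′ :+ b :* a′))
      := (a :* a :- e :* (b :* b)) :* (a′ :* a′ :- e :* (b′ :* b′)))
    refl a b a′ b′ (fromℤ (+ d))
    where open +-*-Solver

  norm-+ : ∀ α β → norm (α + β) ≡ norm α ℚ.+ norm β ℚ.+ trace (α * conj β)
  norm-+ (a +√ b) (a′ +√ b′) = solve 5 (λ a b a′ b′ e →
      (a :+ a′) :* (a :+ a′) :- e :* ((b :+ b′) :* (b :+ b′))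
      := a :* a :- e :* (b :* b) :+ (a′ :* a′ :- e :* (b′ :* b′))
        :+ (a :* a′ :+ e :* (b :* :- b′) :+ (a :* a′ :+ e :* (b :* :- b′))))
    refl a b a′ b′ (fromℤ (+ d))
    where open +-*-Solver

  -- The product of α with its conjugate is almost integral and rational at once. The trace is
  -- treated in the same way through the sum.
  norm-IsInteger : ∀ {α} → AlmostIntegral α → IsInteger (norm α)
  norm-IsInteger {α} h = AlmostIntegral-rational
    (subst AlmostIntegral (α*conj α) (AlmostIntegral-* h (AlmostIntegral-conj h)))

  trace-IsInteger : ∀ {α} → AlmostIntegral α → IsInteger (trace α)
  trace-IsInteger {α} h = AlmostIntegral-rational
    (subst AlmostIntegral (α+conj α) (AlmostIntegral-+ h (AlmostIntegral-conj h)))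

-- The ideal (p, s + √d)

∣-∣-from : ∀ {p q e} → p ≡ q ℕ.+ e → ∣ p - q ∣ ≡ e
∣-∣-from {q = q} {e} refl = trans (ℕ.∣-∣-comm (q ℕ.+ e) q) (ℕ.∣m-m+n∣≡n q e)

pos≡pos+⇒∣-∣ : ∀ a b t → + a ≡ + b ℤ.+ t → ∣ a - b ∣ ≡ ∣ t ∣
pos≡pos+⇒∣-∣ a b (+ c)      eq = ∣-∣-from (ℤ.+-injective eq)
pos≡pos+⇒∣-∣ a b -[1+ c ] eq = trans (ℕ.∣-∣-comm a b) (∣-∣-from (ℤ.+-injective (begin
  + b                                   ≡⟨ lem (+ b) (+ suc c) ⟩
  (+ b ℤ.+ -[1+ c ]) ℤ.+ + suc c        ≡⟨ cong (ℤ._+ + suc c) eq ⟨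
  + a ℤ.+ + suc c                       ∎)))
  where
  open ≡-Reasoning
  lem : ∀ x y → x ≡ (x ℤ.+ ℤ.- y) ℤ.+ y
  lem = ℤ-Solver.solve-∀

i*i≡+∣i∣*∣i∣ : ∀ i → i ℤ.* i ≡ + (∣ i ∣ ℕ.* ∣ i ∣)
i*i≡+∣i∣*∣i∣ (+ n)    = sym (ℤ.pos-* n n)
i*i≡+∣i∣*∣i∣ -[1+ n ] = refl

module IdealAbovePrime (d p s r : ℕ) (d-squarefree : Squarefree d) (p-prime : Prime p)
  (d≡s²+pr : d ≡ s ℕ.* s ℕ.+ p ℕ.* r) (p∤2s : ¬ p ∣ 2 ℕ.* s) where

  open QuadraticField d
  open AlmostIntegral d
  open CommutativeSemiring K-commutativeSemiring using (*-identityʳ; +-identityˡ; +-identityʳ; zeroˡ)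

  instance
    p-nonZero : ℕ.NonZero p
    p-nonZero = prime⇒nonZero p-prime

  γ : K
  γ = fromℤ (+ s) +√ 1ℚ

  unitIdeal 𝔭 : FractionalIdeal
  unitIdeal = record { generators = 1K ∷ [] ; nonzero = here 1K≢0K }
    where
    1K≢0K : 1K ≢ 0K
    1K≢0K ()
  𝔭 = record { generators = ⌊ p ⌋ ∷ γ ∷ [] ; nonzero = here p≢0K }
    where
    p≢0K : ⌊ p ⌋ ≢ 0K
    p≢0K eq = ℕ.≢-nonZero⁻¹ p (ℤ.+-injective (fromℤ-injective (cong ℚ[√_].rat eq)))

  Integral-fromℤ : ∀ i → Integral (rational (fromℤ i))
  Integral-fromℤ i = (ℤ.- i ∷ []) , (begin
    rational (fromℤ (ℤ.- i)) + rational (fromℤ i) * 1K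
      ≡⟨ cong₂ _+_ (cong rational (fromℤ-homo-neg i)) (*-identityʳ (rational (fromℤ i))) ⟩
    rational (ℚ.- fromℤ i ℚ.+ fromℤ i)
      ≡⟨ cong rational (ℚ.+-inverseˡ (fromℤ i)) ⟩
    0K ∎)
    where open ≡-Reasoning

  unitIdeal⊆AlmostIntegral : ∀ {y} → Member unitIdeal y → AlmostIntegral y
  unitIdeal⊆AlmostIntegral (c , .0K , hc , refl , refl) =
    subst AlmostIntegral (sym (trans (+-identityʳ (c * 1K)) (*-identityʳ c)))
      (Integral⇒AlmostIntegral hc)

  1∈unitIdeal : Member unitIdeal 1K
  1∈unitIdeal = 1K , 0K , Integral-fromℤ (+ 1) , refl
    , sym (trans (+-identityʳ (1K * 1K)) (*-identityʳ 1K))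

  0*x+1*y : ∀ x y → 0K * x + (1K * y + 0K) ≡ y
  0*x+1*y x y = trans (cong₂ _+_ (zeroˡ x) (trans (+-identityʳ (1K * y)) (*-identityˡ y))) (+-identityˡ y)

  p∈𝔭 : Member 𝔭 ⌊ p ⌋
  p∈𝔭 = 1K , 0K , Integral-fromℤ (+ 1)
    , (0K , 0K , Integral-fromℤ (+ 0) , refl , sym (trans (+-identityʳ (0K * γ)) (zeroˡ γ)))
    , sym (trans (+-identityʳ (1K * ⌊ p ⌋)) (*-identityˡ ⌊ p ⌋))

  γ∈𝔭 : Member 𝔭 γ
  γ∈𝔭 = 0K , 1K * γ + 0K , Integral-fromℤ (+ 0)
    , (1K , 0K , Integral-fromℤ (+ 1) , refl , refl)
    , sym (0*x+1*y ⌊ p ⌋ γ)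

  𝔭-coefficients : ∀ {x} → Member 𝔭 x →
    ∃₂ λ c e → AlmostIntegral c × AlmostIntegral e × x ≡ ⌊ p ⌋ * c + e * γ
  𝔭-coefficients (c , _ , hc , (e , .0K , he , refl , refl) , refl) =
    c , e , Integral⇒AlmostIntegral hc , Integral⇒AlmostIntegral he ,
    cong₂ _+_ (*-comm c ⌊ p ⌋) (+-identityʳ (e * γ))

  γ-integral : AlmostIntegral γ
  γ-integral = AlmostIntegral-ℤ[√d] ((+ s , refl) ,′ (+ 1 , refl))

  P S R : ℚ
  P = fromℤ (+ p)
  S = fromℤ (+ s)
  R = fromℤ (+ r)

  fromℤ-d : fromℤ (+ d) ≡ S ℚ.* S ℚ.+ P ℚ.* R
  fromℤ-d = begin
    fromℤ (+ d)                                  ≡⟨ cong (λ d → fromℤ (+ d)) d≡s²+pr ⟩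
    fromℤ (+ (s ℕ.* s) ℤ.+ + (p ℕ.* r))          ≡⟨ fromℤ-homo-+ (+ (s ℕ.* s)) (+ (p ℕ.* r)) ⟩
    fromℤ (+ (s ℕ.* s)) ℚ.+ fromℤ (+ (p ℕ.* r))  ≡⟨ cong₂ ℚ._+_ (lem s s) (lem p r) ⟩
    S ℚ.* S ℚ.+ P ℚ.* R                          ∎
    where
    open ≡-Reasoning
    lem : ∀ m n → fromℤ (+ (m ℕ.* n)) ≡ fromℤ (+ m) ℚ.* fromℤ (+ n)
    lem m n = trans (cong fromℤ (ℤ.pos-* m n)) (fromℤ-homo-* (+ m) (+ n))

  norm-γ : norm γ ≡ ℚ.- (P ℚ.* R)
  norm-γ = trans (cong (λ e → S ℚ.* S ℚ.- e ℚ.* (1ℚ ℚ.* 1ℚ)) fromℤ-d)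
    (solve 3 (λ S P R → S :* S :- (S :* S :+ P :* R) :* (con 1ℚ :* con 1ℚ) := :- (P :* R)) refl S P R)
    where open +-*-Solver

  norm-rational : ∀ x → norm (rational x) ≡ x ℚ.* x
  norm-rational x = solve 2 (λ x e → x :* x :- e :* (con 0ℚ :* con 0ℚ) := x :* x) refl x (fromℤ (+ d))
    where open +-*-Solver

  trace-rational* : ∀ x α → trace (rational x * α) ≡ x ℚ.* trace α
  trace-rational* x (a +√ b) = solve 4 (λ x a b e →
      x :* a :+ e :* (con 0ℚ :* b) :+ (x :* a :+ e :* (con 0ℚ :* b)) := x :* (a :+ a))
    refl x a b (fromℤ (+ d))
    where open +-*-Solver

  -- Each of the three terms of the norm of the sum contains p: the norm of p is p², the norm of `γ`
  -- is -pr, and the cross term is p times the trace of an almost integral element.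
  combination-norm : ∀ c e → AlmostIntegral c → AlmostIntegral e →
    ∃ λ j → norm (⌊ p ⌋ * c + e * γ) ≡ fromℤ (+ p ℤ.* j)
  combination-norm c e hc he = let j , hj = cofactor in j , (begin
    norm (⌊ p ⌋ * c + e * γ)
      ≡⟨ norm-+ (⌊ p ⌋ * c) (e * γ) ⟩
    norm (⌊ p ⌋ * c) ℚ.+ norm (e * γ) ℚ.+ trace (⌊ p ⌋ * c * conj (e * γ))
      ≡⟨ cong₂ ℚ._+_ (cong₂ ℚ._+_
           (trans (norm-* ⌊ p ⌋ c) (cong (ℚ._* norm c) (norm-rational P)))
           (trans (norm-* e γ) (cong (norm e ℚ.*_) norm-γ)))
           (trans (cong trace (*-assoc ⌊ p ⌋ c (conj (e * γ))))
             (trace-rational* P (c * conj (e * γ)))) ⟩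
    P ℚ.* P ℚ.* norm c ℚ.+ norm e ℚ.* (ℚ.- (P ℚ.* R)) ℚ.+ P ℚ.* trace (c * conj (e * γ))
      ≡⟨ lem P R (norm c) (norm e) (trace (c * conj (e * γ))) ⟩
    P ℚ.* (P ℚ.* norm c ℚ.+ norm e ℚ.* (ℚ.- R) ℚ.+ trace (c * conj (e * γ)))
      ≡⟨ cong (P ℚ.*_) hj ⟩
    P ℚ.* fromℤ j
      ≡⟨ fromℤ-homo-* (+ p) j ⟨
    fromℤ (+ p ℤ.* j) ∎)
    where
    open ≡-Reasoning
    cofactor : IsInteger (P ℚ.* norm c ℚ.+ norm e ℚ.* (ℚ.- R) ℚ.+ trace (c * conj (e * γ)))
    cofactor = IsInteger-+ {P ℚ.* norm c ℚ.+ norm e ℚ.* (ℚ.- R)}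
      (IsInteger-+ {P ℚ.* norm c}
        (IsInteger-* {P} (+ p , refl) (norm-IsInteger hc))
        (IsInteger-* {norm e} (norm-IsInteger he) (IsInteger-neg {R} (+ r , refl))))
      (trace-IsInteger (AlmostIntegral-* hc (AlmostIntegral-conj (AlmostIntegral-* he γ-integral))))
    lem : ∀ P R n m t → P ℚ.* P ℚ.* n ℚ.+ m ℚ.* (ℚ.- (P ℚ.* R)) ℚ.+ P ℚ.* t
                      ≡ P ℚ.* (P ℚ.* n ℚ.+ m ℚ.* (ℚ.- R) ℚ.+ t)
    lem = solve 5 (λ P R n m t → P :* P :* n :+ m :* (:- (P :* R)) :+ P :* t
                               := P :* (P :* n :+ m :* (:- R) :+ t)) refl
      where open +-*-Solver

  𝔭-norm : ∀ {x} → Member 𝔭 x → ∃ λ j → norm x ≡ fromℤ (+ p ℤ.* j)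
  𝔭-norm x∈𝔭 =
    let c , e , hc , he , x≡ = 𝔭-coefficients x∈𝔭
        j , hj = combination-norm c e hc he
    in j , trans (cong norm x≡) hj

  module Generator (u : K) (u∈𝔭 : Member 𝔭 u)
    (t w : K) (ht : AlmostIntegral t) (hw : AlmostIntegral w)
    (p≡ut : ⌊ p ⌋ ≡ u * t) (γ≡uw : γ ≡ u * w) where

    open ≡-Reasoning

    -- Norms in p = ut multiply to p², and one factor p cancels.
    cofactorNorm : ∀ j → norm u ≡ fromℤ (+ p ℤ.* j) → ∀ l → norm t ≡ fromℤ l → j ℤ.* l ≡ + p
    cofactorNorm j hj l hl = ℤ.*-cancelˡ-≡ (+ p) (j ℤ.* l) (+ p) (fromℤ-injective (begin
      fromℤ (+ p ℤ.* (j ℤ.* l))          ≡⟨ cong fromℤ (ℤ.*-assoc (+ p) j l) ⟨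
      fromℤ (+ p ℤ.* j ℤ.* l)            ≡⟨ fromℤ-homo-* (+ p ℤ.* j) l ⟩
      fromℤ (+ p ℤ.* j) ℚ.* fromℤ l      ≡⟨ cong₂ ℚ._*_ hj hl ⟨
      norm u ℚ.* norm t                  ≡⟨ norm-* u t ⟨
      norm (u * t)                       ≡⟨ cong norm p≡ut ⟨
      norm ⌊ p ⌋                         ≡⟨ norm-rational P ⟩
      P ℚ.* P                            ≡⟨ fromℤ-homo-* (+ p) (+ p) ⟨
      fromℤ (+ p ℤ.* + p)                ∎))

    -- Multiplying `γ ≡ u * w` by t times its conjugate gives `norm t` · γ = p · w · `conj t`. The
    -- traces of both sides are compared, that of `γ` being 2s.
    p∣2s : ∀ l → norm t ≡ fromℤ l → ∣ l ∣ ≡ 1 →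
           ∀ m → trace (w * conj t) ≡ fromℤ m → p ∣ 2 ℕ.* s
    p∣2s l hl ∣l∣≡1 m hm = divides ∣ m ∣ (begin
      2 ℕ.* s                  ≡⟨ cong (s ℕ.+_) (ℕ.+-identityʳ s) ⟩
      s ℕ.+ s                  ≡⟨ ℕ.*-identityˡ (s ℕ.+ s) ⟨
      1 ℕ.* (s ℕ.+ s)          ≡⟨ cong (ℕ._* (s ℕ.+ s)) ∣l∣≡1 ⟨
      ∣ l ∣ ℕ.* (s ℕ.+ s)      ≡⟨ ℤ.abs-* l (+ (s ℕ.+ s)) ⟨
      ∣ l ℤ.* + (s ℕ.+ s) ∣    ≡⟨ cong ∣_∣ eqℤ ⟩
      ∣ + p ℤ.* m ∣            ≡⟨ ℤ.abs-* (+ p) m ⟩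
      p ℕ.* ∣ m ∣              ≡⟨ ℕ.*-comm p ∣ m ∣ ⟩
      ∣ m ∣ ℕ.* p              ∎)
      where
      eqK : rational (norm t) * γ ≡ ⌊ p ⌋ * (w * conj t)
      eqK = begin
        rational (norm t) * γ     ≡⟨ cong₂ _*_ (sym (α*conj t)) γ≡uw ⟩
        (t * conj t) * (u * w)    ≡⟨ *-comm (t * conj t) (u * w) ⟩
        (u * w) * (t * conj t)    ≡⟨ SemiringIdentities.[wx][yz]≈[wy][xz] K-commutativeSemiring u w t (conj t) ⟩
        (u * t) * (w * conj t)    ≡⟨ cong (_* (w * conj t)) p≡ut ⟨
        ⌊ p ⌋ * (w * conj t)      ∎
      eqℤ : l ℤ.* + (s ℕ.+ s) ≡ + p ℤ.* m
      eqℤ = fromℤ-injective (begin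
        fromℤ (l ℤ.* + (s ℕ.+ s))          ≡⟨ fromℤ-homo-* l (+ (s ℕ.+ s)) ⟩
        fromℤ l ℚ.* fromℤ (+ (s ℕ.+ s))    ≡⟨ cong₂ ℚ._*_ (sym hl) (fromℤ-homo-+ (+ s) (+ s)) ⟩
        norm t ℚ.* trace γ                 ≡⟨ trace-rational* (norm t) γ ⟨
        trace (rational (norm t) * γ)      ≡⟨ cong trace eqK ⟩
        trace (⌊ p ⌋ * (w * conj t))       ≡⟨ trace-rational* P (w * conj t) ⟩
        P ℚ.* trace (w * conj t)           ≡⟨ cong (P ℚ.*_) hm ⟩
        P ℚ.* fromℤ m                      ≡⟨ fromℤ-homo-* (+ p) m ⟨
        fromℤ (+ p ℤ.* m)                  ∎)

    -- If t were a unit then p would divide γ, hence also its trace.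
    cofactor-nonunit : ∀ l → norm t ≡ fromℤ l → ∣ l ∣ ≢ 1
    cofactor-nonunit l hl ∣l∣≡1 =
      let m , hm = trace-IsInteger (AlmostIntegral-* hw (AlmostIntegral-conj ht))
      in p∤2s (p∣2s l hl ∣l∣≡1 m hm)

    -- The absolute value of `j` divides the prime p, and the value p would leave the cofactor with
    -- norm ±1.
    ∣j∣≡1 : ∀ j → norm u ≡ fromℤ (+ p ℤ.* j) → ∀ l → norm t ≡ fromℤ l → ∣ j ∣ ≡ 1
    ∣j∣≡1 j hj l hl = [ id , (λ ∣j∣≡p → contradiction (∣l∣≡1 ∣j∣≡p) (cofactor-nonunit l hl)) ]′
      (prime⇒irreducible p-prime (divides ∣ l ∣ (trans (sym ∣j∣∣l∣≡p) (ℕ.*-comm ∣ j ∣ ∣ l ∣))))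
      where
      ∣j∣∣l∣≡p : ∣ j ∣ ℕ.* ∣ l ∣ ≡ p
      ∣j∣∣l∣≡p = trans (sym (ℤ.abs-* j l)) (cong ∣_∣ (cofactorNorm j hj l hl))
      ∣l∣≡1 : ∣ j ∣ ≡ p → ∣ l ∣ ≡ 1
      ∣l∣≡1 ∣j∣≡p = ℕ.*-cancelˡ-≡ ∣ l ∣ 1 p
        (trans (cong (ℕ._* ∣ l ∣) (sym ∣j∣≡p)) (trans ∣j∣∣l∣≡p (sym (ℕ.*-identityʳ p))))

    norm-p : ∃ λ j → norm u ≡ fromℤ (+ p ℤ.* j) × ∣ j ∣ ≡ 1
    norm-p =
      let j , hj = 𝔭-norm u∈𝔭
          l , hl = norm-IsInteger ht
      in j , hj , ∣j∣≡1 j hj l hl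

  -- The coordinates of an integral element are half-integers, so the norm equation is
  -- multiplied by 4.
  doubledCoordinates : ∀ u → AlmostIntegral u → ∀ i → norm u ≡ fromℤ i →
    ∃₂ λ x y → ∣ x ℕ.* x - d ℕ.* (y ℕ.* y) ∣ ≡ 4 ℕ.* ∣ i ∣
  doubledCoordinates (x +√ y) hu i hi =
    let X , hX = trace-IsInteger hu
        -- Here `d` times (2y)² is the integer (2x)² - 4i, and `d` is squarefree, so 2y is an
        -- integer.
        Y , hY = squarefree-IsInteger d-squarefree (y ℚ.+ y) dYY
    in ∣ X ∣ , ∣ Y ∣ , trans (pos≡pos+⇒∣-∣ (∣ X ∣ ℕ.* ∣ X ∣) (d ℕ.* (∣ Y ∣ ℕ.* ∣ Y ∣)) (+ 4 ℤ.* i)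
                                (integerEq X Y hX hY))
                             (ℤ.abs-* (+ 4) i)
    where
    open ≡-Reasoning
    E F : ℚ
    E = fromℤ (+ d)
    F = fromℤ (+ 4 ℤ.* i)
    lem₁ : ∀ x y e → (x ℚ.+ x) ℚ.* (x ℚ.+ x)
      ≡ e ℚ.* ((y ℚ.+ y) ℚ.* (y ℚ.+ y)) ℚ.+ fromℤ (+ 4) ℚ.* (x ℚ.* x ℚ.- e ℚ.* (y ℚ.* y))
    lem₁ = solve 3 (λ x y e → (x :+ x) :* (x :+ x)
      := e :* ((y :+ y) :* (y :+ y)) :+ con (fromℤ (+ 4)) :* (x :* x :- e :* (y :* y))) refl
      where open +-*-Solver
    lem₂ : ∀ a b c → a ≡ b ℚ.+ c → a ℚ.+ ℚ.- c ≡ b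
    lem₂ _ b c refl = solve 2 (λ b c → b :+ c :+ :- c := b) refl b c
      where open +-*-Solver
    normEq : (x ℚ.+ x) ℚ.* (x ℚ.+ x) ≡ E ℚ.* ((y ℚ.+ y) ℚ.* (y ℚ.+ y)) ℚ.+ F
    normEq = trans (lem₁ x y E) (cong (E ℚ.* ((y ℚ.+ y) ℚ.* (y ℚ.+ y)) ℚ.+_)
      (trans (cong (fromℤ (+ 4) ℚ.*_) hi) (sym (fromℤ-homo-* (+ 4) i))))
    dYY : IsInteger (E ℚ.* ((y ℚ.+ y) ℚ.* (y ℚ.+ y)))
    dYY = subst IsInteger (lem₂ ((x ℚ.+ x) ℚ.* (x ℚ.+ x)) (E ℚ.* ((y ℚ.+ y) ℚ.* (y ℚ.+ y))) F normEq)
      (IsInteger-+ {(x ℚ.+ x) ℚ.* (x ℚ.+ x)}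
        (IsInteger-* {x ℚ.+ x} {x ℚ.+ x} (trace-IsInteger hu) (trace-IsInteger hu))
        (IsInteger-neg {F} (+ 4 ℤ.* i , refl)))
    integerEq : ∀ X Y → x ℚ.+ x ≡ fromℤ X → y ℚ.+ y ≡ fromℤ Y →
      + (∣ X ∣ ℕ.* ∣ X ∣) ≡ + (d ℕ.* (∣ Y ∣ ℕ.* ∣ Y ∣)) ℤ.+ + 4 ℤ.* i
    integerEq X Y hX hY = begin
      + (∣ X ∣ ℕ.* ∣ X ∣)                             ≡⟨ i*i≡+∣i∣*∣i∣ X ⟨
      X ℤ.* X                                         ≡⟨ fromℤ-injective rationalEq ⟩
      + d ℤ.* (Y ℤ.* Y) ℤ.+ + 4 ℤ.* i                 ≡⟨ cong (λ y → + d ℤ.* y ℤ.+ + 4 ℤ.* i) (i*i≡+∣i∣*∣i∣ Y) ⟩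
      + d ℤ.* + (∣ Y ∣ ℕ.* ∣ Y ∣) ℤ.+ + 4 ℤ.* i       ≡⟨ cong (ℤ._+ + 4 ℤ.* i) (ℤ.pos-* d (∣ Y ∣ ℕ.* ∣ Y ∣)) ⟨
      + (d ℕ.* (∣ Y ∣ ℕ.* ∣ Y ∣)) ℤ.+ + 4 ℤ.* i       ∎
      where
      rationalEq : fromℤ (X ℤ.* X) ≡ fromℤ (+ d ℤ.* (Y ℤ.* Y) ℤ.+ + 4 ℤ.* i)
      rationalEq = begin
        fromℤ (X ℤ.* X)
          ≡⟨ fromℤ-homo-* X X ⟩
        fromℤ X ℚ.* fromℤ X
          ≡⟨ cong (λ x → x ℚ.* x) hX ⟨
        (x ℚ.+ x) ℚ.* (x ℚ.+ x)
          ≡⟨ normEq ⟩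
        E ℚ.* ((y ℚ.+ y) ℚ.* (y ℚ.+ y)) ℚ.+ F
          ≡⟨ cong (λ y → E ℚ.* (y ℚ.* y) ℚ.+ F) hY ⟩
        E ℚ.* (fromℤ Y ℚ.* fromℤ Y) ℚ.+ F
          ≡⟨ cong (λ q → E ℚ.* q ℚ.+ F) (fromℤ-homo-* Y Y) ⟨
        E ℚ.* fromℤ (Y ℤ.* Y) ℚ.+ F
          ≡⟨ cong (ℚ._+ F) (fromℤ-homo-* (+ d) (Y ℤ.* Y)) ⟨
        fromℤ (+ d ℤ.* (Y ℤ.* Y)) ℚ.+ F
          ≡⟨ fromℤ-homo-+ (+ d ℤ.* (Y ℤ.* Y)) (+ 4 ℤ.* i) ⟨
        fromℤ (+ d ℤ.* (Y ℤ.* Y) ℤ.+ + 4 ℤ.* i) ∎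

  𝔭⊆AlmostIntegral : ∀ {x} → Member 𝔭 x → AlmostIntegral x
  𝔭⊆AlmostIntegral x∈𝔭 =
    let c , e , hc , he , x≡ = 𝔭-coefficients x∈𝔭
    in subst AlmostIntegral (sym x≡) (AlmostIntegral-+
      (AlmostIntegral-* (AlmostIntegral-ℤ[√d] (ℤ[√d]-rational (+ p , refl))) hc)
      (AlmostIntegral-* he γ-integral))

  -- The scalar `u` relating the two ideals is a generator of `𝔭`: it is the image of 1, and the
  -- membership of p and `γ` in its multiples yields the cofactors `t` and `w`.
  principal⇒norm4p : unitIdeal ∼ 𝔭 → ∃₂ λ x y → ∣ x ℕ.* x - d ℕ.* (y ℕ.* y) ∣ ≡ 4 ℕ.* p
  principal⇒norm4p (u , v , uv≡1 , 𝔭⊆u , u⊆𝔭) =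
    let t , t∈O , p≡ut = 𝔭⊆u p∈𝔭
        w , w∈O , γ≡uw = 𝔭⊆u γ∈𝔭
        u∈𝔭 = u⊆𝔭 (1K , 1∈unitIdeal , sym (*-identityʳ u))
        j , hj , ∣j∣≡1 = Generator.norm-p u u∈𝔭 t w (unitIdeal⊆AlmostIntegral t∈O)
                           (unitIdeal⊆AlmostIntegral w∈O) p≡ut γ≡uw
        x , y , eq = doubledCoordinates u (𝔭⊆AlmostIntegral u∈𝔭) (+ p ℤ.* j) hj
    in x , y , trans eq (cong (4 ℕ.*_) (trans (ℤ.abs-* (+ p) j)
         (trans (cong (p ℕ.*_) ∣j∣≡1) (ℕ.*-identityʳ p))))

-- Small values of the principal form

open import Data.Nat
open import Data.Nat.Properties

∣-∣-swap : ∀ t {p q p′ q′} → p ≡ t + q′ → q ≡ t + p′ → ∣ p - q ∣ ≡ ∣ p′ - q′ ∣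
∣-∣-swap t {p′ = p′} {q′} refl refl = trans (∣m+n-m+o∣≡∣n-o∣ t q′ p′) (∣-∣-comm q′ p′)

split : ∀ v c → (∃ λ w → v + w ≡ c) ⊎ (∃ λ v′ → v ≡ v′ + c)
split v c with ≤-total v c
... | inj₁ v≤c = inj₁ (c ∸ v , m+[n∸m]≡n v≤c)
... | inj₂ c≤v = inj₂ (v ∸ c , sym (m∸n+n≡m c≤v))

module PowerForms (b s m : ℕ) .{{_ : NonZero b}}
  (m<n : m < 4 * b * s + 1) (m≢□ : ∀ u → u * u ≢ m) where

  n : ℕ
  n = 4 * b * s + 1

  n>0 : n > 0
  n>0 = m≤n+m 1 (4 * b * s)

  instance
    n-nonZero : NonZero n
    n-nonZero = >-nonZero n>0

  -- With N = n x y, B x y is the form of coefficients n y, 2 (b N − s), − n x; both forms are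
  -- written as distances so that no subtraction is needed.
  opaque
    A B : ℕ → ℕ → ℕ → ℕ → ℕ
    A x y u v = ∣ x * (u * u) + 2 * (b * x * y + s) * (u * v) - y * (v * v) ∣
    B x y u v = ∣ n * y * (u * u) + 2 * b * (n * x * y) * (u * v)
                - n * x * (v * v) + 2 * s * (u * v) ∣

  n≤⇒≢ : ∀ {e} → n ≤ e → e ≢ m
  n≤⇒≢ n≤e refl = <⇒≱ m<n n≤e

  -- For i = 0 the value is a square. For positive i it is 0, again a square, or at least n.
  n^i*u²≢m : ∀ i u → n ^ i * (u * u) ≢ m
  n^i*u²≢m zero    u       eq = m≢□ u (trans (sym (*-identityˡ (u * u))) eq)
  n^i*u²≢m (suc i) zero    eq = m≢□ 0 (trans (sym (*-zeroʳ (n ^ suc i))) eq)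
  n^i*u²≢m (suc i) u@(suc _)  = n≤⇒≢ (begin
    n                    ≤⟨ m≤m*n n (n ^ i) {{m^n≢0 n i}} ⟩
    n * n ^ i            ≤⟨ m≤m*n (n ^ suc i) (u * u) ⟩
    n * n ^ i * (u * u)  ∎)
    where open ≤-Reasoning

  opaque
    unfolding A B

    A-u≡0 : ∀ x y v → A x y 0 v ≡ y * (v * v)
    A-u≡0 x y v = cong ∣_- y * (v * v) ∣ (lem x (2 * (b * x * y + s)))
      where
      lem : ∀ x t → x * 0 + t * 0 ≡ 0
      lem = solve-∀

    B-u≡0 : ∀ x y v → B x y 0 v ≡ n * x * (v * v)
    B-u≡0 x y v = cong₂ ∣_-_∣ (lem (n * y) (2 * b * (n * x * y))) (lem′ (n * x * (v * v)) s)
      where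
      lem : ∀ x t → x * 0 + t * 0 ≡ 0
      lem = solve-∀
      lem′ : ∀ x t → x + 2 * t * 0 ≡ x
      lem′ = solve-∀

    -- v ≤ 2 b x u says that v / u is at most the partial quotient of the form; then all
    -- terms of its value are nonnegative.
    A-cone : ∀ x y u v w → v + w ≡ 2 * b * x * u →
             A x y u v ≡ x * (u * u) + v * (2 * s * u + y * w)
    A-cone x y u v w eq = ∣-∣-from (begin
      x * (u * u) + 2 * (b * x * y + s) * (u * v)
        ≡⟨ l₁ b s x y u v ⟩
      x * (u * u) + y * v * (2 * b * x * u) + 2 * s * u * v
        ≡⟨ cong (λ c → x * (u * u) + y * v * c + 2 * s * u * v) eq ⟨
      x * (u * u) + y * v * (v + w) + 2 * s * u * v
        ≡⟨ l₂ s x y u v w ⟩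
      y * (v * v) + (x * (u * u) + v * (2 * s * u + y * w)) ∎)
      where
      open ≡-Reasoning
      l₁ : ∀ b s x y u v → x * (u * u) + 2 * (b * x * y + s) * (u * v)
                         ≡ x * (u * u) + y * v * (2 * b * x * u) + 2 * s * u * v
      l₁ = solve-∀
      l₂ : ∀ s x y u v w → x * (u * u) + y * v * (v + w) + 2 * s * u * v
                         ≡ y * (v * v) + (x * (u * u) + v * (2 * s * u + y * w))
      l₂ = solve-∀

    -- At w = 0 the cross term becomes 4bs · x u², which together with x u² makes n · x u².
    A-end : ∀ x y u → A x y u (2 * b * x * u) ≡ n * x * (u * u)
    A-end x y u = trans (A-cone x y u _ 0 (+-identityʳ _)) (lem b s x y u)
      where
      lem : ∀ b s x y u → x * (u * u) + 2 * b * x * u * (2 * s * u + y * 0)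
                        ≡ (4 * b * s + 1) * x * (u * u)
      lem = solve-∀

    A-last-cone : ∀ x u v w → v + w ≡ 2 * (b * x * 1 + s) * u →
                  A x 1 u v ≡ x * (u * u) + v * w
    A-last-cone x u v w eq = ∣-∣-from (begin
      x * (u * u) + 2 * (b * x * 1 + s) * (u * v)
        ≡⟨ l₁ (x * (u * u)) (2 * (b * x * 1 + s)) u v ⟩
      x * (u * u) + v * (2 * (b * x * 1 + s) * u)
        ≡⟨ cong (λ c → x * (u * u) + v * c) eq ⟨
      x * (u * u) + v * (v + w)
        ≡⟨ l₂ (x * (u * u)) v w ⟩
      1 * (v * v) + (x * (u * u) + v * w) ∎)
      where
      open ≡-Reasoning
      l₁ : ∀ x c u v → x + c * (u * v) ≡ x + v * (c * u)
      l₁ = solve-∀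
      l₂ : ∀ x v w → x + v * (v + w) ≡ 1 * (v * v) + (x + v * w)
      l₂ = solve-∀

    -- As n = 4bs + 1, the term n y u² splits into y u² and 2su · 2byu. The second part outweighs
    -- the subtracted 2suv inside the cone.
    B-cone : ∀ x y u v w → v + w ≡ 2 * b * y * u →
             B x y u v ≡ y * (u * u) + w * (2 * s * u + n * x * v)
    B-cone x y u v w eq = ∣-∣-from (begin
      n * y * (u * u) + 2 * b * (n * x * y) * (u * v)
        ≡⟨ l₁ b s n x y u v ⟩
      y * (u * u) + 2 * s * u * (2 * b * y * u) + n * x * v * (2 * b * y * u)
        ≡⟨ cong (λ c → y * (u * u) + 2 * s * u * c + n * x * v * c) eq ⟨
      y * (u * u) + 2 * s * u * (v + w) + n * x * v * (v + w)
        ≡⟨ l₂ s n x y u v w ⟩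
      n * x * (v * v) + 2 * s * (u * v) + (y * (u * u) + w * (2 * s * u + n * x * v)) ∎)
      where
      open ≡-Reasoning
      l₁ : ∀ b s n x y u v → (4 * b * s + 1) * y * (u * u) + 2 * b * (n * x * y) * (u * v)
         ≡ y * (u * u) + 2 * s * u * (2 * b * y * u) + n * x * v * (2 * b * y * u)
      l₁ = solve-∀
      l₂ : ∀ s n x y u v w → y * (u * u) + 2 * s * u * (v + w) + n * x * v * (v + w)
         ≡ n * x * (v * v) + 2 * s * (u * v) + (y * (u * u) + w * (2 * s * u + n * x * v))
      l₂ = solve-∀

    B-v≡0 : ∀ x y u → B x y u 0 ≡ n * y * (u * u)
    B-v≡0 x y u = ∣-∣-from (lem n b s x y u)
      where
      lem : ∀ n b s x y u → n * y * (u * u) + 2 * b * (n * x * y) * (u * 0)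
          ≡ n * x * 0 + 2 * s * (u * 0) + n * y * (u * u)
      lem = solve-∀

    -- The shift of v by the partial quotient 2bx, with the variables exchanged, carries one form to
    -- the negative of the next. The first argument of `∣-∣-swap` is what the two sides of the
    -- distance have in common.
    A-step : ∀ x y u v → A x (n * y) u (v + 2 * b * x * u) ≡ B x y v u
    A-step x y u v = ∣-∣-swap
      (2 * b * x * (n * y) * (u * v) + 4 * (b * b) * (x * x) * (n * y) * (u * u))
      (l₁ b s x (n * y) u v) (l₂ b n x y u v)
      where
      l₁ : ∀ b s x y u v →
        x * (u * u) + 2 * (b * x * y + s) * (u * (v + 2 * b * x * u))
        ≡ (2 * b * x * y * (u * v) + 4 * (b * b) * (x * x) * y * (u * u))
          + ((4 * b * s + 1) * x * (u * u) + 2 * s * (v * u))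
      l₁ = solve-∀
      l₂ : ∀ b n x y u v →
        n * y * ((v + 2 * b * x * u) * (v + 2 * b * x * u))
        ≡ (2 * b * x * (n * y) * (u * v) + 4 * (b * b) * (x * x) * (n * y) * (u * u))
          + (n * y * (v * v) + 2 * b * (n * x * y) * (v * u))
      l₂ = solve-∀

    -- Together with `A-step` this moves one factor n from the last coefficient to the first.
    B-step : ∀ x y u v → B x y u (v + 2 * b * y * u) ≡ A (n * x) y v u
    B-step x y u v = ∣-∣-swap
      (2 * b * n * x * y * (u * v) + 4 * (b * b) * (n * x) * (y * y) * (u * u)
        + 4 * b * s * y * (u * u))
      (l₁ b s n x y u v) (l₂ b s n x y u v)
      where
      l₁ : ∀ b s n x y u v →
        (4 * b * s + 1) * y * (u * u) + 2 * b * (n * x * y) * (u * (v + 2 * b * y * u))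
        ≡ (2 * b * n * x * y * (u * v) + 4 * (b * b) * (n * x) * (y * y) * (u * u)
            + 4 * b * s * y * (u * u))
          + y * (u * u)
      l₁ = solve-∀
      l₂ : ∀ b s n x y u v →
        n * x * ((v + 2 * b * y * u) * (v + 2 * b * y * u)) + 2 * s * (u * (v + 2 * b * y * u))
        ≡ (2 * b * n * x * y * (u * v) + 4 * (b * b) * (n * x) * (y * y) * (u * u)
            + 4 * b * s * y * (u * u))
          + (n * x * (v * v) + 2 * (b * (n * x) * y + s) * (v * u))
      l₂ = solve-∀

    -- Closes the cycle when all factors n have moved. For y = 1 the contribution 2s / y no longer
    -- vanishes in the partial quotient, which is therefore 2(bx + s).
    A-last-step : ∀ x u v → A x 1 u (v + 2 * (b * x * 1 + s) * u) ≡ A 1 x v u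
    A-last-step x u v = ∣-∣-swap
      (2 * (b * x * 1 + s) * (u * v) + 4 * (b * x * 1 + s) * (b * x * 1 + s) * (u * u))
      (l₁ x (b * x * 1 + s) u v) (l₂ b s x u v)
      where
      l₁ : ∀ x a u v → x * (u * u) + 2 * a * (u * (v + 2 * a * u))
         ≡ (2 * a * (u * v) + 4 * a * a * (u * u)) + x * (u * u)
      l₁ = solve-∀
      l₂ : ∀ b s x u v →
        1 * ((v + 2 * (b * x * 1 + s) * u) * (v + 2 * (b * x * 1 + s) * u))
        ≡ (2 * (b * x * 1 + s) * (u * v) + 4 * (b * x * 1 + s) * (b * x * 1 + s) * (u * u))
          + (1 * (v * v) + 2 * (b * 1 * x + s) * (v * u))
      l₂ = solve-∀

    -- Substituting x = w + ay with a = bN + s removes a² from the coefficient a² + N and leaves the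
    -- form with coefficients 1, 2a, -N.
    A-init : ∀ N w y → ∣ (w + (b * N + s) * y) * (w + (b * N + s) * y)
                       - (N + (b * N + s) ^ 2) * (y * y) ∣ ≡ A 1 N w y
    A-init N w y = trans
      (cong₂ ∣_-_∣ (l₁ b s N y w) (l₂ N (b * N + s) y))
      (∣m+n-m+o∣≡∣n-o∣ ((b * N + s) * (b * N + s) * (y * y)) _ _)
      where
      l₁ : ∀ b s N y w → (w + (b * N + s) * y) * (w + (b * N + s) * y)
         ≡ (b * N + s) * (b * N + s) * (y * y) + (1 * (w * w) + 2 * (b * 1 * N + s) * (w * y))
      l₁ = solve-∀
      l₂ : ∀ N a y → (N + a * (a * 1)) * (y * y) ≡ a * a * (y * y) + N * (y * y)
      l₂ = solve-∀

  -- Descent along the cycle of forms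

  smaller : ∀ u v c .{{_ : NonZero c}} .{{_ : NonZero u}} → v + u < u + (v + c * u)
  smaller u v c = begin-strict
    v + u            ≡⟨ +-comm v u ⟩
    u + v            <⟨ +-monoʳ-< u (m<m+n v (>-nonZero⁻¹ _ {{m*n≢0 c u}})) ⟩
    u + (v + c * u)  ∎
    where open ≤-Reasoning

  n≤nt+vw : ∀ r q t v w .{{_ : NonZero t}} .{{_ : NonZero v}} .{{_ : NonZero w}} →
            n ≤ r + v * (q + n * t * w)
  n≤nt+vw r q t v w = begin
    n                        ≤⟨ m≤m*n n t ⟩
    n * t                    ≤⟨ m≤m*n (n * t) w ⟩
    n * t * w                ≤⟨ m≤n+m _ q ⟩
    q + n * t * w            ≤⟨ m≤n*m _ v ⟩
    v * (q + n * t * w)      ≤⟨ m≤n+m _ r ⟩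
    r + v * (q + n * t * w)  ∎
    where open ≤-Reasoning

  2bx≢0 : ∀ i → NonZero (2 * b * n ^ i)
  2bx≢0 i = m*n≢0 (2 * b) (n ^ i) {{m*n≢0 2 b}} {{m^n≢0 n i}}

  2[bx+s]≢0 : ∀ i → NonZero (2 * (b * n ^ i * 1 + s))
  2[bx+s]≢0 i = >-nonZero (begin-strict
    0                            <⟨ >-nonZero⁻¹ b ⟩
    b                            ≤⟨ m≤m*n b (n ^ i) {{m^n≢0 n i}} ⟩
    b * n ^ i                    ≤⟨ m≤m*n _ 1 ⟩
    b * n ^ i * 1                ≤⟨ m≤m+n _ s ⟩
    b * n ^ i * 1 + s            ≤⟨ m≤n*m _ 2 ⟩
    2 * (b * n ^ i * 1 + s)      ∎)
    where open ≤-Reasoning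

  -- Induction on u + v. Beyond the cone a reduction step lowers the sum; on its two edges the value
  -- is a power of n times a square; strictly inside it is at least n. The condition on `i + j`
  -- excludes the form u² + 2(b + s)uv - v², whose values in the cone have no such lower bound.
  A≢m : ∀ i j u v → .{{_ : NonZero (i + j)}} → Acc _<_ (u + v) → A (n ^ i) (n ^ j) u v ≢ m
  B≢m : ∀ i j u v → Acc _<_ (u + v) → B (n ^ i) (n ^ j) u v ≢ m

  A≢m i j zero v _ eq = n^i*u²≢m j v (trans (sym (A-u≡0 (n ^ i) (n ^ j) v)) eq)
  A≢m i (suc j) u@(suc _) v (acc rs) eq with split v (2 * b * n ^ i * u)
  A≢m i (suc j) u@(suc _) v (acc rs) eq | inj₂ (v′ , refl) =
    B≢m i j v′ u (rs (smaller u v′ _ {{2bx≢0 i}})) (trans (sym (A-step (n ^ i) (n ^ j) u v′)) eq)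
  A≢m i (suc j) u@(suc _) zero (acc rs) eq | inj₁ (w , e) =
    n^i*u²≢m i u (trans (sym (trans (A-cone (n ^ i) (n ^ suc j) u 0 w e) (+-identityʳ _))) eq)
  A≢m i (suc j) u@(suc _) v@(suc _) (acc rs) eq | inj₁ (zero , e) =
    n^i*u²≢m (suc i) u (trans (sym (A-end (n ^ i) (n ^ suc j) u))
      (trans (cong (A (n ^ i) (n ^ suc j) u) (trans (sym e) (+-identityʳ v))) eq))
  A≢m i (suc j) u@(suc _) v@(suc _) (acc rs) eq | inj₁ (w@(suc _) , e) =
    n≤⇒≢ (n≤nt+vw (n ^ i * (u * u)) (2 * s * u) (n ^ j) v w {{m^n≢0 n j}})
      (trans (sym (A-cone (n ^ i) (n ^ suc j) u v w e)) eq)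
  -- With y = 1 the exponent of x is positive, so x u² alone already reaches n in the whole cone.
  A≢m (suc i) zero u@(suc _) v (acc rs) eq with split v (2 * (b * n ^ suc i * 1 + s) * u)
  ... | inj₂ (v′ , refl) =
    A≢m 0 (suc i) v′ u (rs (smaller u v′ _ {{2[bx+s]≢0 (suc i)}}))
      (trans (sym (A-last-step (n ^ suc i) u v′)) eq)
  ... | inj₁ (w , e) = n≤⇒≢ n≤ (trans (sym (A-last-cone (n ^ suc i) u v w e)) eq)
    where
    open ≤-Reasoning
    n≤ : n ≤ n ^ suc i * (u * u) + v * w
    n≤ = begin
      n                              ≤⟨ m≤m*n n (n ^ i) {{m^n≢0 n i}} ⟩
      n * n ^ i                      ≤⟨ m≤m*n _ (u * u) ⟩
      n * n ^ i * (u * u)            ≤⟨ m≤m+n _ _ ⟩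
      n * n ^ i * (u * u) + v * w    ∎

  B≢m i j zero v _ eq = n^i*u²≢m (suc i) v (trans (sym (B-u≡0 (n ^ i) (n ^ j) v)) eq)
  B≢m i j u@(suc _) v (acc rs) eq with split v (2 * b * n ^ j * u)
  B≢m i j u@(suc _) v (acc rs) eq | inj₂ (v′ , refl) =
    A≢m (suc i) j v′ u (rs (smaller u v′ _ {{2bx≢0 j}})) (trans (sym (B-step (n ^ i) (n ^ j) u v′)) eq)
  B≢m i j u@(suc _) zero (acc rs) eq | inj₁ (w , e) =
    n^i*u²≢m (suc j) u (trans (sym (B-v≡0 (n ^ i) (n ^ j) u)) eq)
  B≢m i j u@(suc _) v@(suc _) (acc rs) eq | inj₁ (zero , e) =
    n^i*u²≢m j u (trans (sym (trans (B-cone (n ^ i) (n ^ j) u v 0 e) (+-identityʳ _))) eq)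
  B≢m i j u@(suc _) v@(suc _) (acc rs) eq | inj₁ (w@(suc _) , e) =
    n≤⇒≢ (n≤nt+vw (n ^ j * (u * u)) (2 * s * u) (n ^ i) w v {{m^n≢0 n i}})
      (trans (sym (B-cone (n ^ i) (n ^ j) u v w e)) eq)

  -- For x at least ay, with a = bN + s, the descent applies. Below that, D y² - x² is at least N
  -- y², hence at least n, unless x = y = 0 and the value is the square 0.
  ∣x²-Dy²∣≢m : ∀ k .{{_ : NonZero k}} x y →
    ∣ x * x - (n ^ k + (b * n ^ k + s) ^ 2) * (y * y) ∣ ≢ m
  ∣x²-Dy²∣≢m k x y eq with split x ((b * n ^ k + s) * y)
  ... | inj₂ (w , refl) =
    A≢m 0 k w y (<-wellFounded _) (trans (sym (A-init (n ^ k) w y)) eq)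
  ∣x²-Dy²∣≢m k x zero eq | inj₁ (w , e) = m≢□ 0 (trans (sym (cong₂ ∣_-_∣
    (cong (λ x → x * x) (m+n≡0⇒m≡0 x (trans e (*-zeroʳ (b * n ^ k + s)))))
    (*-zeroʳ (n ^ k + (b * n ^ k + s) ^ 2)))) eq)
  ∣x²-Dy²∣≢m k@(suc k-1) x y@(suc _) eq | inj₁ (w , e) =
    n≤⇒≢ n≤ (trans (sym (trans (∣-∣-comm (x * x) _) (∣-∣-from lem))) eq)
    where
    l₁ : ∀ N a y → (N + a * (a * 1)) * (y * y) ≡ N * (y * y) + (a * y) * (a * y)
    l₁ = solve-∀
    l₂ : ∀ N x w → N + (x + w) * (x + w) ≡ x * x + (N + w * (2 * x + w))
    l₂ = solve-∀
    lem : (n ^ k + (b * n ^ k + s) ^ 2) * (y * y)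
        ≡ x * x + (n ^ k * (y * y) + w * (2 * x + w))
    lem = begin
      (n ^ k + (b * n ^ k + s) ^ 2) * (y * y)
        ≡⟨ l₁ (n ^ k) (b * n ^ k + s) y ⟩
      n ^ k * (y * y) + ((b * n ^ k + s) * y) * ((b * n ^ k + s) * y)
        ≡⟨ cong (λ c → n ^ k * (y * y) + c * c) e ⟨
      n ^ k * (y * y) + (x + w) * (x + w)
        ≡⟨ l₂ (n ^ k * (y * y)) x w ⟩
      x * x + (n ^ k * (y * y) + w * (2 * x + w)) ∎
      where open ≡-Reasoning
    n≤ : n ≤ n ^ k * (y * y) + w * (2 * x + w)
    n≤ = begin
      n                                    ≤⟨ m≤m*n n (n ^ k-1) {{m^n≢0 n k-1}} ⟩
      n * n ^ k-1                          ≤⟨ m≤m*n _ (y * y) ⟩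
      n ^ k * (y * y)                      ≤⟨ m≤m+n _ _ ⟩
      n ^ k * (y * y) + w * (2 * x + w)    ∎
      where open ≤-Reasoning

-- Prime factors and class numbers

prime≢□ : ∀ {p} → Prime p → ∀ u → u * u ≢ p
prime≢□ p-prime u refl with prime⇒irreducible p-prime (m∣m*n {u} u)
... | inj₁ refl = ¬prime[1] p-prime
... | inj₂ u≡u² = ¬prime[1] (subst Prime u*u≡1 p-prime)
  where
  u*u≡1 : u * u ≡ 1
  u*u≡1 = *-cancelˡ-≡ (u * u) 1 (u * u) {{prime⇒nonZero p-prime}}
    (trans (cong₂ _*_ (sym u≡u²) (sym u≡u²)) (sym (*-identityʳ (u * u))))

2∣x²⇒2∣x : ∀ x → 2 ∣ x * x → 2 ∣ x
2∣x²⇒2∣x x 2∣x² = [ id , id ]′ (euclidsLemma x x prime[2] 2∣x²)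

4prime≢□ : ∀ {p} → Prime p → ∀ u → u * u ≢ 4 * p
4prime≢□ {p} p-prime u eq with 2∣x²⇒2∣x u (subst (2 ∣_) (sym eq) (∣m⇒∣m*n p (divides 2 refl)))
... | divides c refl = prime≢□ p-prime c (*-cancelˡ-≡ (c * c) p 4 (trans (lem c) eq))
  where
  lem : ∀ c → 4 * (c * c) ≡ c * 2 * (c * 2)
  lem = solve-∀

∣∣m-n∣∣n⇒∣m : ∀ {i} m n → i ∣ ∣ m - n ∣ → i ∣ n → i ∣ m
∣∣m-n∣∣n⇒∣m {i} m n i∣m-n i∣n with ≤-total m n
... | inj₁ m≤n = ∣m+n∣m⇒∣n (subst (i ∣_) (sym (m∸n+n≡m m≤n)) i∣n)
                   (subst (i ∣_) (m≤n⇒∣m-n∣≡n∸m m≤n) i∣m-n)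
... | inj₂ n≤m = ∣m∸n∣n⇒∣m i n≤m (subst (i ∣_) (m≤n⇒∣n-m∣≡n∸m n≤m) i∣m-n) i∣n

-- Modulo 2 the equation makes x even. Then 4 divides (4e + 2)y², so y is even too, and 4 cancels.
halve : ∀ e p x y → ∣ x * x - (4 * e + 2) * (y * y) ∣ ≡ 4 * p →
  ∃₂ λ x′ y′ → ∣ x′ * x′ - (4 * e + 2) * (y′ * y′) ∣ ≡ p
halve e p x y eq = x′ , y′ , *-cancelˡ-≡ _ p 4 (begin
  4 * ∣ x′ * x′ - D′ * (y′ * y′) ∣              ≡⟨ *-distribˡ-∣-∣ 4 (x′ * x′) _ ⟩
  ∣ 4 * (x′ * x′) - 4 * (D′ * (y′ * y′)) ∣      ≡⟨ cong₂ ∣_-_∣ (l₁ x′) (l₂ D′ y′) ⟩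
  ∣ x′ * 2 * (x′ * 2) - D′ * (y′ * 2 * (y′ * 2)) ∣
    ≡⟨ cong₂ (λ x y → ∣ x * x - D′ * (y * y) ∣) (_∣_.equality 2∣x) (_∣_.equality 2∣y) ⟨
  ∣ x * x - D′ * (y * y) ∣                      ≡⟨ eq ⟩
  4 * p                                         ∎)
  where
  open ≡-Reasoning
  D′ = 4 * e + 2
  l₁ : ∀ x → 4 * (x * x) ≡ x * 2 * (x * 2)
  l₁ = solve-∀
  l₂ : ∀ d y → 4 * (d * (y * y)) ≡ d * (y * 2 * (y * 2))
  l₂ = solve-∀
  l₃ : ∀ e y → (4 * e + 2) * y ≡ 4 * (e * y) + 2 * y
  l₃ = solve-∀
  l₄ : ∀ e → 4 * e + 2 ≡ (2 * e + 1) * 2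
  l₄ = solve-∀
  2∣x : 2 ∣ x
  2∣x = 2∣x²⇒2∣x x (∣∣m-n∣∣n⇒∣m (x * x) (D′ * (y * y))
    (subst (2 ∣_) (sym eq) (∣m⇒∣m*n p (divides 2 refl)))
    (∣m⇒∣m*n (y * y) (divides (2 * e + 1) (l₄ e))))
  x′ = quotient 2∣x
  4∣x² : 4 ∣ x * x
  4∣x² = subst (λ x → 4 ∣ x * x) (sym (_∣_.equality 2∣x)) (subst (4 ∣_) (l₁ x′) (m∣m*n (x′ * x′)))
  4∣Dy² : 4 ∣ D′ * (y * y)
  4∣Dy² = ∣∣m-n∣∣n⇒∣m (D′ * (y * y)) (x * x)
    (subst (4 ∣_) (trans (sym eq) (∣-∣-comm (x * x) _)) (m∣m*n p)) 4∣x²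
  2∣y : 2 ∣ y
  2∣y = 2∣x²⇒2∣x y (*-cancelˡ-∣ 2 (∣m+n∣m⇒∣n
    (subst (4 ∣_) (l₃ e (y * y)) 4∣Dy²) (m∣m*n (e * (y * y)))))
  y′ = quotient 2∣y

primeFactor : ∀ n .{{_ : NonTrivial n}} → ∃ λ p → Prime p × p ∣ n
primeFactor n with factorise n {{nonTrivial⇒nonZero n}}
... | record { factors = []    ; isFactorisation = n≡1 } =
  contradiction n≡1 (nonTrivial⇒≢1 {n})
... | record { factors = p ∷ ps ; isFactorisation = refl ; factorsPrime = p-prime ∷ _ } =
  p , p-prime , m∣m*n _

-- A prime factor p of the smaller of two complementary divisors d ≤ e works: its cofactor is a
-- multiple of e, so p ≤ d ≤ e ≤ q.
smallPrimeFactor : ∀ n → Composite n → ∃₂ λ p q → Prime p × n ≡ p * q × p ≤ q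
smallPrimeFactor n (hasNonTrivialDivisor {d} d<n (divides e n≡ed)) =
  [ (λ d≤e → go d e n≡de d≤e)
  , (λ e≤d → go e d {{n>1⇒nonTrivial 1<e}} n≡ed e≤d) ]′ (≤-total d e)
  where
  n≡de : n ≡ d * e
  n≡de = trans n≡ed (*-comm e d)
  1<e : 1 < e
  1<e = *-cancelʳ-< d 1 e (subst₂ _<_ (sym (*-identityˡ d)) n≡ed d<n)
  go : ∀ d e → .{{_ : NonTrivial d}} → n ≡ d * e → d ≤ e → ∃₂ λ p q → Prime p × n ≡ p * q × p ≤ q
  go d e n≡de d≤e with primeFactor d
  ... | p , p-prime , divides c refl = p , c * e , p-prime ,
    trans n≡de (trans (cong (_* e) (*-comm c p)) (*-assoc p c e)) , (begin
      p      ≤⟨ m≤n*m p c {{m*n≢0⇒m≢0 c {{nonTrivial⇒nonZero (c * p)}}}} ⟩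
      c * p  ≤⟨ d≤e ⟩
      e      ≤⟨ m≤n*m e c {{m*n≢0⇒m≢0 c {{nonTrivial⇒nonZero (c * p)}}}} ⟩
      c * e  ∎)
    where open ≤-Reasoning

-- By surjectivity `Fin 0` leaves no class for `I`, and `Fin 1` puts `I` and `J` into the class of
-- its only element.
classNumber>1 : ∀ {d} h → IsClassNumber d h → ∀ I J → ¬ QuadraticField._∼_ d I J → h > 1
classNumber>1 {d} h bij I J I≁J = go h bij
  where
  open QuadraticField d using (_∼_; ∼-sym; ∼-trans)
  go : ∀ h → IsClassNumber d h → h > 1
  go zero bij with Bijection.strictlySurjective bij I
  ... | () , _
  go (suc zero) bij = contradiction I∼J I≁J
    where
    open Bijection bij using (to; strictlySurjective)
    to0∼ : ∀ L → to Fin.zero ∼ L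
    to0∼ L with strictlySurjective L
    ... | Fin.zero , eq = eq
    I∼J : I ∼ J
    I∼J = ∼-trans {I} {to Fin.zero} {J} (∼-sym {to Fin.zero} {I} (to0∼ I)) (to0∼ J)
  go (suc (suc h)) bij = s≤s (s≤s z≤n)

-- The exceptional value n = 9

9^k≡1mod4 : ∀ k → ∃ λ t → 9 ^ k ≡ 4 * t + 1
9^k≡1mod4 zero    = 0 , refl
9^k≡1mod4 (suc k) with 9^k≡1mod4 k
... | t , eq = 9 * t + 2 , trans (cong (9 *_) eq) (lem t)
  where
  lem : ∀ t → 9 * (4 * t + 1) ≡ 4 * (9 * t + 2) + 1
  lem = solve-∀

-- Here bs = 2, so one of b and s is odd and the other even. With N ≡ 1 (mod 4) the number bN + s is
-- odd, and D is 1 plus an odd square modulo 4. The witnesses come from expanding with N = 4t + 1.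
D≡2mod4 : ∀ b s k → 4 * b * s + 1 ≡ 9 → ∃ λ e → D b s k ≡ 4 * e + 2
D≡2mod4 b s k n≡9 =
  let t , eq = 9^k≡1mod4 k
      N≡ = trans (cong (_^ k) n≡9) eq
  in [ (λ { (b≡1 , s≡2) → 4 * (t * t) + 7 * t + 2 , trans (cong (λ N → N + (b * N + s) ^ 2) N≡)
             (trans (cong₂ (λ b s → (4 * t + 1) + (b * (4 * t + 1) + s) ^ 2) b≡1 s≡2) (l₁ t)) })
     , (λ { (b≡2 , s≡1) → 16 * (t * t) + 13 * t + 2 , trans (cong (λ N → N + (b * N + s) ^ 2) N≡)
             (trans (cong₂ (λ b s → (4 * t + 1) + (b * (4 * t + 1) + s) ^ 2) b≡2 s≡1) (l₂ t)) })
     ]′ (factors b s (*-cancelˡ-≡ (b * s) 2 4 (trans (sym (*-assoc 4 b s)) (suc-injective (trans (sym (+-comm _ 1)) n≡9)))))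
  where
  l₁ : ∀ t → (4 * t + 1) + (1 * (4 * t + 1) + 2) * ((1 * (4 * t + 1) + 2) * 1) ≡ 4 * (4 * (t * t) + 7 * t + 2) + 2
  l₁ = solve-∀
  l₂ : ∀ t → (4 * t + 1) + (2 * (4 * t + 1) + 1) * ((2 * (4 * t + 1) + 1) * 1) ≡ 4 * (16 * (t * t) + 13 * t + 2) + 2
  l₂ = solve-∀
  factors : ∀ b s → b * s ≡ 2 → (b ≡ 1 × s ≡ 2) ⊎ (b ≡ 2 × s ≡ 1)
  factors b s bs≡2 with prime⇒irreducible prime[2] (divides s (trans (sym bs≡2) (*-comm b s)))
  ... | inj₁ refl = inj₁ (refl , trans (sym (*-identityˡ s)) bs≡2)
  ... | inj₂ refl = inj₂ (refl , *-cancelˡ-≡ s 1 2 bs≡2)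

-- The contradiction for n = pq

module CompositeCase (b s k p q : ℕ) .{{_ : NonZero b}} .{{_ : NonZero k}}
  (D-squarefree : Squarefree (D b s k)) (p-prime : Prime p)
  (n≡pq : 4 * b * s + 1 ≡ p * q) (p≤q : p ≤ q) where

  -- Expanding the square shows that D - s² is a multiple of N, and N contains a factor n = pq
  -- because k is positive.
  d≡s²+pr : D b s k ≡ s * s + p * (q * (4 * b * s + 1) ^ pred k
    * (1 + b * b * (4 * b * s + 1) ^ k + 2 * b * s))
  d≡s²+pr = begin
    N + (b * N + s) ^ 2                        ≡⟨ l₁ N b s ⟩
    s * s + N * (1 + b * b * N + 2 * b * s)
      ≡⟨ cong (λ M → s * s + M * (1 + b * b * N + 2 * b * s)) N≡ ⟩
    s * s + p * q * M * (1 + b * b * N + 2 * b * s)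
      ≡⟨ l₂ (s * s) p q M (1 + b * b * N + 2 * b * s) ⟩
    s * s + p * (q * M * (1 + b * b * N + 2 * b * s)) ∎
    where
    open ≡-Reasoning
    N = (4 * b * s + 1) ^ k
    M = (4 * b * s + 1) ^ pred k
    N≡ : N ≡ p * q * M
    N≡ = trans (cong ((4 * b * s + 1) ^_) (sym (suc-pred k))) (cong (_* M) n≡pq)
    l₁ : ∀ N b s → N + (b * N + s) * ((b * N + s) * 1) ≡ s * s + N * (1 + b * b * N + 2 * b * s)
    l₁ = solve-∀
    l₂ : ∀ x p q M y → x + p * q * M * y ≡ x + p * (q * M * y)
    l₂ = solve-∀

  p∤2s : ¬ p ∣ 2 * s
  p∤2s p∣2s = ¬prime[1] (subst Prime (∣1⇒≡1 p∣1) p-prime)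
    where
    lem : ∀ b s → 2 * s * (2 * b) ≡ 4 * b * s
    lem = solve-∀
    p∣1 : p ∣ 1
    p∣1 = ∣m+n∣m⇒∣n (subst (p ∣_) (sym n≡pq) (m∣m*n q))
            -- If p divided 2s it would divide 2s · 2b = n - 1 as well as n.
            (subst (p ∣_) (lem b s) (∣m⇒∣m*n (2 * b) p∣2s))

  open IdealAbovePrime (D b s k) p s _ D-squarefree p-prime d≡s²+pr p∤2s

  2∤n : ¬ 2 ∣ 4 * b * s + 1
  2∤n 2∣n = contradiction (∣1⇒≡1 (∣m+n∣m⇒∣n 2∣n (∣m⇒∣m*n s (∣m⇒∣m*n b (divides 2 refl))))) λ ()

  oddBetween2And4 : ∀ x → ¬ 2 ∣ x → 1 < x → x ≤ 4 → x ≡ 3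
  oddBetween2And4 1 _ (s≤s ()) _
  oddBetween2And4 2 2∤x _ _ = contradiction (divides 1 refl) 2∤x
  oddBetween2And4 3 _ _ _ = refl
  oddBetween2And4 4 2∤x _ _ = contradiction (divides 2 refl) 2∤x
  oddBetween2And4 (suc (suc (suc (suc (suc x))))) _ _ (s≤s (s≤s (s≤s (s≤s ()))))

  1<p : 1 < p
  1<p = nonTrivial⇒n>1 p {{prime⇒nonTrivial p-prime}}

  -- Only n = 9 violates 4p < n.  There D ≡ 2 (mod 4), so the coordinates are integers.
  noNorm4p : ∀ x y → ∣ x * x - D b s k * (y * y) ∣ ≢ 4 * p
  noNorm4p x y eq with 4 * p <? 4 * b * s + 1
  ... | yes 4p<n = PowerForms.∣x²-Dy²∣≢m b s (4 * p) 4p<n (4prime≢□ p-prime) k x y eq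
  ... | no 4p≮n =
    let e , D≡ = D≡2mod4 b s k (trans n≡pq (cong₂ _*_ p≡3 q≡3))
        x′ , y′ , eq′ = halve e p x y (subst (λ d → ∣ x * x - d * (y * y) ∣ ≡ 4 * p) D≡ eq)
    in PowerForms.∣x²-Dy²∣≢m b s p p<n (prime≢□ p-prime) k x′ y′
         (subst (λ d → ∣ x′ * x′ - d * (y′ * y′) ∣ ≡ p) (sym D≡) eq′)
    where
    -- Cancelling p in pq ≤ 4p bounds q, and since n is odd, 1 < p ≤ q ≤ 4 leaves only p = q = 3.
    q≤4 : q ≤ 4
    q≤4 = *-cancelˡ-≤ p {{prime⇒nonZero p-prime}}
      (subst₂ _≤_ n≡pq (*-comm 4 p) (≮⇒≥ 4p≮n))
    p≡3 : p ≡ 3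
    p≡3 = oddBetween2And4 p (λ 2∣p → 2∤n (subst (2 ∣_) (sym n≡pq) (∣m⇒∣m*n q 2∣p)))
      1<p (≤-trans p≤q q≤4)
    q≡3 : q ≡ 3
    q≡3 = oddBetween2And4 q (λ 2∣q → 2∤n (subst (2 ∣_) (sym n≡pq) (∣n⇒∣m*n p 2∣q)))
      (<-≤-trans 1<p p≤q) q≤4
    p<n : p < 4 * b * s + 1
    p<n = subst₂ _<_ (sym p≡3) (sym (trans n≡pq (cong₂ _*_ p≡3 q≡3))) (s≤s (s≤s (s≤s (s≤s z≤n))))

  h>1 : ∀ h → IsClassNumber (D b s k) h → h > 1
  h>1 h bij = classNumber>1 h bij unitIdeal 𝔭 λ principal →
    let x , y , eq = principal⇒norm4p principal in noNorm4p x y eq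

proposition1p4 : ∀ (b s k : ℕ) → b > 0 → s > 0 → k > 0 →
    Squarefree (D b s k) →
    ¬ Prime (4 * b * s + 1) →
    ∀ (h : ℕ) → IsClassNumber (D b s k) h → h > 1
proposition1p4 b s k b>0 s>0 k>0 D-squarefree ¬n-prime =
  let p , q , p-prime , n≡pq , p≤q = smallPrimeFactor (4 * b * s + 1) n-composite
  in CompositeCase.h>1 b s k p q {{>-nonZero b>0}} {{>-nonZero k>0}} D-squarefree p-prime n≡pq p≤q
  where
  1<n : 1 < 4 * b * s + 1
  1<n = +-monoˡ-< 1 (*-mono-< (*-mono-< {0} {4} {0} z<s b>0) s>0)
  n-composite : Composite (4 * b * s + 1)
  n-composite = ¬prime⇒composite {{n>1⇒nonTrivial 1<n}} ¬n-prime
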